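{- Let $k$ be a positive integer. Every graph $G$ of order $n\ge 6k-4$ with $\Delta(G)=2$ is $k$-placeable.
   Context: All graphs are finite and simple; $\Delta(G)$ is the maximum degree. For a graph $G$ on $n$ vertices, a $k$-placement of $G$ is a $k$-tuple $(\phi_1,\dots,\phi_k)$ of bijections $\phi_i:V(G)\to V(K_n)$ such that the edge sets $\phi_i(E(G))=\{\phi_i(x)\phi_i(y):xy\in E(G)\}$ are pairwise disjoint; $G$ is $k$-placeable if it has one. -}

module Defs where

open import Data.Fin.Base using (Fin)
open import Data.Fin.Permutation using (Permutation′; _⟨$⟩ʳ_)
open import Data.List.Base using (map) renaming (allFin to allFinₗ)
open import Data.List.Extrema.Nat using (max)
open import Data.Nat.Base using (ℕ)
open import Data.Product.Base using (_×_; _,_; ∃; ∃₂)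
open import Data.Vec.Base using (count; allFin)
open import Level using (0ℓ)
open import Relation.Binary.Core using (Rel)
open import Relation.Binary.Definitions using (Symmetric; Irreflexive; Decidable)
open import Relation.Binary.PropositionalEquality.Core using (_≡_; _≢_)
open import Relation.Unary using (Pred; _⊥_)

record Graph (n : ℕ) : Set₁ where
  field
    Adj    : Rel (Fin n) 0ℓ
    adj?   : Decidable Adj
    sym    : Symmetric Adj
    irrefl : Irreflexive _≡_ Adj

module _ {n : ℕ} (G : Graph n) where
  open Graph G

  degree : Fin n → ℕ
  degree x = count (adj? x) (allFin n)

  -- The base value 0 matters only for the graph with no vertices.
  Δ : ℕ
  Δ = max 0 (map degree (allFinₗ n))

  -- φ(E(G)) as a set of ordered pairs: since Adj is symmetric, it contains
  -- (u , v) exactly when it contains (v , u), so two such sets are disjoint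
  -- exactly when the corresponding sets of unordered edges are.
  imageEdges : Permutation′ n → Pred (Fin n × Fin n) 0ℓ
  imageEdges φ (u , v) = ∃₂ λ x y → Adj x y × u ≡ φ ⟨$⟩ʳ x × v ≡ φ ⟨$⟩ʳ y

  -- V(Kₙ) is Fin n, so the bijections V(G) → V(Kₙ) are the permutations
  -- of Fin n.
  IsPlacement : (k : ℕ) → (Fin k → Permutation′ n) → Set
  IsPlacement k φ = ∀ i j → i ≢ j → imageEdges (φ i) ⊥ imageEdges (φ j)

  Placeable : ℕ → Set
  Placeable k = ∃ (IsPlacement k)

{-# OPTIONS --safe #-}
module Submission where

-- Split V(G) into a set of fixed vertices and two rows of equal length m, and
-- let the j-th copy of G arise by rotating both rows by j places. An edge at a
-- fixed vertex never repeats if each fixed vertex has at most one neighbour in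
-- either row. Since paths on at least three vertices may be closed, G may be
-- taken to consist of cycles and at most two further vertices; labelling each
-- cycle by concatenated blocks 012, 0102 and 01122 (0 fixed, 1 and 2 the rows)
-- achieves this and leaves few edges between row vertices. Place these edges so
-- that the positions of their ends have a constant sum. Rotation by 0 < d < k
-- changes the sum by 2 d, so a repetition forces 2 d = m. If m = 2 h with h < k,
-- the bound n ≥ 6 k - 4 yields a block 0102, and its row vertices serve as a
-- gap: the two halves of the rows get sums of different parity.

open import Defs
open import Data.Bool.Base using (Bool; true; false; not)
open import Data.Empty using (⊥; ⊥-elim)
open import Data.Fin.Base as Fin using (Fin; toℕ; zero; suc; punchOut)
open import Data.Fin.Permutation using (Permutation′) renaming (id to id-permutation)
import Data.Fin.Properties as Finₚ
open import Data.List.Base using (List; []; _∷_; _++_; [_]; map; length; lookup; reverse; _∷ʳ_) renaming (allFin to allFinₗ)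
open import Data.List.Extrema.Nat using (xs≤max)
open import Data.List.Membership.Propositional using (_∈_; _∉_; find)
open import Data.List.Membership.Propositional.Properties using (∈-++⁻; ∈-++⁺ˡ; ∈-++⁺ʳ; ∈-∃++; ∈-allFin; ∈-map⁺)
import Data.List.Properties as Listₚ
open import Data.List.Relation.Binary.Permutation.Propositional using (_↭_; ↭-refl; ↭-reflexive; ↭-sym; ↭-trans; ↭⇒↭ₛ)
open import Data.List.Relation.Binary.Permutation.Propositional.Properties using (∈-resp-↭; ↭-length; shift; ++⁺ʳ; ++⁺ˡ)
import Data.List.Relation.Binary.Permutation.Setoid.Properties as Permutationₛ
open import Data.List.Relation.Binary.Subset.Propositional using (_⊆_)
open import Data.List.Relation.Unary.All as All using (All; []; _∷_)
import Data.List.Relation.Unary.All.Properties as Allₚ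
open import Data.List.Relation.Unary.AllPairs using ([]; _∷_)
open import Data.List.Relation.Unary.Any as Any using (here; there; index)
open import Data.List.Relation.Unary.Any.Properties using (lookup-index)
open import Data.List.Relation.Unary.Linked as Linked using (Linked; []; [-]; _∷_)
open import Data.List.Relation.Unary.Unique.Propositional using (Unique)
import Data.List.Relation.Unary.Unique.Propositional.Properties as Uniqueₚ
open import Data.Nat.Base
open import Data.Nat.DivMod
open import Data.Nat.Properties
open import Data.Nat.Tactic.RingSolver using (solve-∀)
open import Data.Product.Base using (_×_; _,_; ∃; ∃₂; proj₁; proj₂; uncurry)
open import Data.Product.Function.NonDependent.Propositional using (_×-↔_)
open import Data.Product.Properties using (,-injective; ,-injectiveˡ)
open import Data.Sum.Base as Sum using (_⊎_; inj₁; inj₂; [_,_]′)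
open import Data.Sum.Function.Propositional using (_⊎-↔_)
open import Data.Sum.Properties using (inj₂-injective)
open import Data.Unit.Base using (⊤; tt)
import Data.Vec.Base as Vec
import Data.Vec.Properties as Vecₚ
open import Function.Base using (_∘_; id; flip; case_of_)
open import Function.Bundles using (_↔_; Inverse; mk↔ₛ′)
open import Function.Construct.Composition using (_↔-∘_)
open import Function.Construct.Identity using (↔-id)
open import Function.Definitions using (Injective)
open import Level using (0ℓ)
open import Relation.Binary.Core using (Rel)
open import Relation.Binary.Definitions using (tri<; tri≈; tri>)
open import Relation.Binary.PropositionalEquality hiding ([_])
open import Relation.Nullary using (¬_; yes; no; contradiction)
open import Relation.Unary using (Pred; Decidable)

-- Closing a path costs nothing because only upper bounds on neighbourhoods are used: every
-- neighbour of a vertex is one of two named vertices, whether or not these are adjacent to it. The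
-- block lengths 3, 4 and 5 are the possible remainders when threes are cut off a cycle. The
-- obstacle is the rotation by half a row, which can preserve position sums; it occurs among the
-- copies only if m ≤ 2 k - 2. The blocks 012, 0102, 01122 spend 3, 4 and 5 vertices on 1, 1 and 2
-- columns. With r blocks 0102 and q blocks 01122 this gives n ≤ 3 m + r - q + 1, the 1 allowing for
-- a leftover fixed vertex. Without a block 0102, n ≥ 6 k - 4 then forces m ≥ 2 k - 1. So a harmful
-- half turn always comes with a column free of edges between row vertices.

-- Finite bijections and rotations modulo m.

injective⇒hits : ∀ {n} {f : Fin n → Fin n} → Injective _≡_ _≡_ f →
                 ∀ y → ∃ λ x → f x ≡ y
injective⇒hits {suc n} {f} inj y with Finₚ.any? (λ x → f x Finₚ.≟ y)
... | yes hit = hit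
... | no miss = contradiction (n<1+n n) (≤⇒≯ (Finₚ.injective⇒≤ avoid-injective))
  where
  missed : ∀ x → y ≢ f x
  missed x eq = miss (x , sym eq)
  avoid-injective : Injective _≡_ _≡_ (λ x → punchOut (missed x))
  avoid-injective eq = inj (Finₚ.punchOut-injective (missed _) (missed _) eq)

injective⇒permutation : ∀ {n} (f : Fin n → Fin n) → Injective _≡_ _≡_ f → Permutation′ n
injective⇒permutation f inj = mk↔ₛ′ f (proj₁ ∘ hits) (proj₂ ∘ hits) (λ x → inj (proj₂ (hits (f x))))
  where hits = injective⇒hits inj

-- A section of `f` is injective, so the sizes agree and the section is onto; `f` inverts it. Thanks
-- to this, a layout has distinct entries as soon as it covers all vertices and has the right size.
surjective⇒injective : ∀ {N n} → N ≤ n → (f : Fin N → Fin n) →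
                       (∀ y → ∃ λ x → f x ≡ y) → Injective _≡_ _≡_ f
surjective⇒injective {N} {n} N≤n f surj =
  conclude (≤-antisym N≤n (Finₚ.injective⇒≤ section-injective))
  where
  section : Fin n → Fin N
  section = proj₁ ∘ surj
  section-injective : Injective _≡_ _≡_ section
  section-injective {x} {y} eq =
    trans (sym (proj₂ (surj x))) (trans (cong f eq) (proj₂ (surj y)))
  conclude : N ≡ n → Injective _≡_ _≡_ f
  conclude refl {a} {b} eq with injective⇒hits section-injective a | injective⇒hits section-injective b
  ... | x , refl | y , refl =
    cong section (trans (sym (proj₂ (surj x))) (trans eq (proj₂ (surj y))))

-- Congruence of a + d and b modulo m, for a, b < m and d ≤ m.
Step : ℕ → ℕ → ℕ → ℕ → Set
Step m d a b = a + d ≡ b ⊎ a + d ≡ b + m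

module _ {m : ℕ} .{{_ : NonZero m}} where

  rotate : ℕ → Fin m → Fin m
  rotate j u = (toℕ u + j) mod m

  private
    toℕ-rotate : ∀ j u → toℕ (rotate j u) ≡ (toℕ u + j) % m
    toℕ-rotate j u = Finₚ.toℕ-fromℕ< _

  %-cancelʳ-+ : ∀ {a b} i → a < m → (a + i) % m ≡ (b + i) % m → b % m ≡ a
  %-cancelʳ-+ {a} {b} i a<m eq = begin
    b % m                          ≡⟨ [m+kn]%n≡m%n b q m ⟨
    (b + q * m) % m                ≡⟨ cong (_% m) shifted ⟩
    (a + q′ * m) % m               ≡⟨ [m+kn]%n≡m%n a q′ m ⟩
    a % m                          ≡⟨ m<n⇒m%n≡m a<m ⟩
    a                              ∎
    where
    open ≡-Reasoning
    q = (a + i) / m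
    q′ = (b + i) / m
    swap : ∀ x y z → x + y + z ≡ (x + z) + y
    swap = solve-∀
    shifted : b + q * m ≡ a + q′ * m
    shifted = +-cancelʳ-≡ i (b + q * m) (a + q′ * m) (begin
      b + q * m + i                          ≡⟨ swap b (q * m) i ⟩
      (b + i) + q * m                        ≡⟨ cong (_+ q * m) (m≡m%n+[m/n]*n (b + i) m) ⟩
      (b + i) % m + q′ * m + q * m           ≡⟨ cong (λ r → r + q′ * m + q * m) eq ⟨
      (a + i) % m + q′ * m + q * m           ≡⟨ swap ((a + i) % m) (q′ * m) (q * m) ⟩
      (a + i) % m + q * m + q′ * m           ≡⟨ cong (_+ q′ * m) (m≡m%n+[m/n]*n (a + i) m) ⟨
      (a + i) + q′ * m                       ≡⟨ swap a i (q′ * m) ⟩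
      a + q′ * m + i                         ∎)

  rotate-residue : ∀ {u v : Fin m} i d → rotate i u ≡ rotate (d + i) v → (toℕ v + d) % m ≡ toℕ u
  rotate-residue {u} {v} i d eq = %-cancelʳ-+ i (Finₚ.toℕ<n u)
    (trans (sym (toℕ-rotate i u)) (trans (cong toℕ eq)
      (trans (toℕ-rotate (d + i) v) (cong (_% m) (sym (+-assoc (toℕ v) d i))))))

  -- As `d ≤ m`, the sum `toℕ v + d` stays below 2 m and wraps around at most once.
  rotate-step : ∀ {u v : Fin m} i d → d ≤ m → rotate i u ≡ rotate (d + i) v →
                Step m d (toℕ v) (toℕ u)
  rotate-step {u} {v} i d d≤m eq with toℕ v + d <? m
  ... | yes lt = inj₁ (trans (sym (m<n⇒m%n≡m lt)) (rotate-residue i d eq))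
  ... | no ≮m = inj₂ (begin
      b                ≡⟨ m∸n+n≡m (≮⇒≥ ≮m) ⟨
      b ∸ m + m        ≡⟨ cong (_+ m) (m<n⇒m%n≡m below) ⟨
      (b ∸ m) % m + m  ≡⟨ cong (_+ m) (m≤n⇒[n∸m]%m≡n%m (≮⇒≥ ≮m)) ⟩
      b % m + m        ≡⟨ cong (_+ m) (rotate-residue i d eq) ⟩
      toℕ u + m        ∎)
    where
    open ≡-Reasoning
    b = toℕ v + d
    below : b ∸ m < m
    below = +-cancelʳ-< m (b ∸ m) m
      (subst (_< m + m) (sym (m∸n+n≡m (≮⇒≥ ≮m))) (+-mono-<-≤ (Finₚ.toℕ<n v) d≤m))

  rotate-injective : ∀ j → Injective _≡_ _≡_ (rotate j)
  rotate-injective j {u} {v} eq with rotate-step j 0 z≤n eq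
  ... | inj₁ v≡u = Finₚ.toℕ-injective (trans (sym v≡u) (+-identityʳ _))
  ... | inj₂ v≡u+m = contradiction (Finₚ.toℕ<n v)
    (≤⇒≯ (subst (m ≤_) (trans (sym v≡u+m) (+-identityʳ _)) (m≤n+m m (toℕ u))))

-- Placements obtained by rotating two rows.

-- `R` holds for the positions of the ends of an edge, and `d` is the difference of the indices of
-- two copies: no edge may be rotated onto another by `d`.
ConflictFree : ℕ → ℕ → Rel ℕ 0ℓ → Set
ConflictFree k m R = ∀ {d u v u′ v′} → 0 < d → d < k → u < m → v < m → u′ < m → v′ < m →
                     R u v → R u′ v′ → Step m d u u′ → Step m d v v′ → ⊥

module Rotating {n k z m} (G : Graph n) .{{_ : NonZero m}} (k≤m : k ≤ m)
  (fixed : Fin z → Fin n) (row : Bool → Fin m → Fin n)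
  (onto : ∀ v → (∃ λ i → fixed i ≡ v) ⊎ (∃₂ λ c u → row c u ≡ v))
  (size : z + 2 * m ≤ n)
  where

  open Graph G using (Adj)

  Place : Set
  Place = Fin z ⊎ Bool × Fin m

  at : Place → Fin n
  at = [ fixed , uncurry row ]′

  private
    places : Fin (z + 2 * m) ↔ Place
    places = (↔-id _ ⊎-↔ ((Finₚ.2↔Bool ×-↔ ↔-id _) ↔-∘ Finₚ.*↔×)) ↔-∘ Finₚ.+↔⊎

    open Inverse places using (to; from; strictlyInverseˡ)

    at⁻¹ : ∀ v → ∃ λ p → at p ≡ v
    at⁻¹ v with onto v
    ... | inj₁ (i , eq)     = inj₁ i , eq
    ... | inj₂ (c , u , eq) = inj₂ (c , u) , eq

    at∘to-injective : Injective _≡_ _≡_ (at ∘ to)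
    at∘to-injective = surjective⇒injective size (at ∘ to) λ v →
      let p , at-p≡v = at⁻¹ v in from p , trans (cong at (strictlyInverseˡ p)) at-p≡v

  at-injective : Injective _≡_ _≡_ at
  at-injective {p} {q} eq = trans (sym (strictlyInverseˡ p)) (trans (cong to from≡) (strictlyInverseˡ q))
    where
    from≡ : from p ≡ from q
    from≡ = at∘to-injective (trans (cong at (strictlyInverseˡ p))
              (trans eq (cong at (sym (strictlyInverseˡ q)))))

  turn : ℕ → Place → Place
  turn j (inj₁ i)       = inj₁ i
  turn j (inj₂ (c , u)) = inj₂ (c , rotate j u)

  turn-injective : ∀ j → Injective _≡_ _≡_ (turn j)
  turn-injective j {inj₁ _} {inj₁ _} refl = refl
  turn-injective j {inj₂ (c , u)} {inj₂ (c′ , u′)} eq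
    with ,-injective (inj₂-injective eq)
  ... | refl , eq′ = cong (λ w → inj₂ (c , w)) (rotate-injective j eq′)

  move : ℕ → Fin n → Fin n
  move j v = at (turn j (proj₁ (at⁻¹ v)))

  move-injective : ∀ j → Injective _≡_ _≡_ (move j)
  move-injective j {v} {w} eq = trans (sym (proj₂ (at⁻¹ v)))
    (trans (cong at (turn-injective j {proj₁ (at⁻¹ v)} {proj₁ (at⁻¹ w)} (at-injective eq)))
      (proj₂ (at⁻¹ w)))

  module _
    (R : Bool → Bool → Rel ℕ 0ℓ)
    (fixed-independent : ∀ i j → ¬ Adj (fixed i) (fixed j))
    (one-per-row : ∀ i c {u u′} → Adj (fixed i) (row c u) → Adj (fixed i) (row c u′) → u ≡ u′)
    (row-edges : ∀ {c c′ u u′} → Adj (row c u) (row c′ u′) → R c c′ (toℕ u) (toℕ u′))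
    (free : ∀ c c′ → ConflictFree k m (R c c′))
    where

    private
      not-stationary : ∀ {d i u u′} → u ≡ u′ → 0 < d → d < k →
                       rotate i u ≡ rotate (d + i) u′ → ⊥
      not-stationary {d} {i} {u} refl 0<d d<k eq
        with rotate-step i d (≤-trans (<⇒≤ d<k) k≤m) eq
      ... | inj₁ eq′ = <⇒≢ 0<d (+-cancelˡ-≡ (toℕ u) 0 d (trans (+-identityʳ _) (sym eq′)))
      ... | inj₂ eq′ = <⇒≢ (<-≤-trans d<k k≤m) (+-cancelˡ-≡ (toℕ u) d m eq′)

      -- `turn` keeps fixed places and rows apart, so only edges of the same kind can coincide. At a
      -- fixed vertex, `one-per-row` makes the row ends equal, and no row position is stationary
      -- under `d`. Edges between row vertices are left to `free`.
      no-overlap : ∀ {d i} p q p′ q′ → 0 < d → d < k → Adj (at p) (at q) → Adj (at p′) (at q′) →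
                   turn i p ≡ turn (d + i) p′ → turn i q ≡ turn (d + i) q′ → ⊥
      no-overlap (inj₁ _) (inj₁ _) _ _ _ _ A _ _ _ = fixed-independent _ _ A
      no-overlap (inj₁ _) (inj₂ (c , _)) (inj₁ _) (inj₂ _) 0<d d<k A A′ refl eq
        with ,-injective (inj₂-injective eq)
      ... | refl , eq′ = not-stationary (one-per-row _ c A A′) 0<d d<k eq′
      no-overlap (inj₂ (c , _)) (inj₁ _) (inj₂ _) (inj₁ _) 0<d d<k A A′ eq refl
        with ,-injective (inj₂-injective eq)
      ... | refl , eq′ = not-stationary (one-per-row _ c (Graph.sym G A) (Graph.sym G A′)) 0<d d<k eq′
      no-overlap {d} {i} (inj₂ (c , _)) (inj₂ (c′ , _)) (inj₂ _) (inj₂ _) 0<d d<k A A′ eq₁ eq₂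
        with ,-injective (inj₂-injective eq₁) | ,-injective (inj₂-injective eq₂)
      ... | refl , eq₁′ | refl , eq₂′ =
        free c c′ 0<d d<k (Finₚ.toℕ<n _) (Finₚ.toℕ<n _) (Finₚ.toℕ<n _) (Finₚ.toℕ<n _)
          -- `A′` comes first: it lies in the later copy, so `d` is added to its positions.
          (row-edges A′) (row-edges A) (step eq₁′) (step eq₂′)
        where
        step : ∀ {u v} → rotate i u ≡ rotate (d + i) v → Step m d (toℕ v) (toℕ u)
        step = rotate-step i d (≤-trans (<⇒≤ d<k) k≤m)

      earlier-later : ∀ {i j x y x′ y′} → i < j → j < k → Adj x y → Adj x′ y′ →
                      move i x ≡ move j x′ → move i y ≡ move j y′ → ⊥
      earlier-later {i} {j} {x} {y} {x′} {y′} i<j j<k A A′ eq₁ eq₂ =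
        no-overlap {j ∸ i} {i} (proj₁ (at⁻¹ x)) (proj₁ (at⁻¹ y)) (proj₁ (at⁻¹ x′)) (proj₁ (at⁻¹ y′))
          (m<n⇒0<n∸m i<j) (≤-<-trans (m∸n≤m j i) j<k)
          (subst₂ Adj (sym (proj₂ (at⁻¹ x))) (sym (proj₂ (at⁻¹ y))) A)
          (subst₂ Adj (sym (proj₂ (at⁻¹ x′))) (sym (proj₂ (at⁻¹ y′))) A′)
          (later eq₁) (later eq₂)
        where
        later : ∀ {p q} → at (turn i p) ≡ at (turn j q) → turn i p ≡ turn (j ∸ i + i) q
        later {p} {q} eq = trans (at-injective eq)
          (cong (λ l → turn l q) (sym (m∸n+n≡m (<⇒≤ i<j))))

    placeable : Placeable G k
    placeable = φ , disjoint
      where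
      φ : Fin k → Permutation′ n
      φ j = injective⇒permutation (move (toℕ j)) (move-injective (toℕ j))
      disjoint : IsPlacement G k φ
      disjoint i j i≢j ((x , y , A , eqx , eqy) , (x′ , y′ , A′ , eqx′ , eqy′))
        with <-cmp (toℕ i) (toℕ j)
      ... | tri< i<j _ _ = earlier-later i<j (Finₚ.toℕ<n j) A A′ (trans (sym eqx) eqx′) (trans (sym eqy) eqy′)
      ... | tri≈ _ i≡j _ = i≢j (Finₚ.toℕ-injective i≡j)
      ... | tri> _ _ j<i = earlier-later j<i (Finₚ.toℕ<n i) A′ A (trans (sym eqx′) eqx) (trans (sym eqy′) eqy)

-- Positions in lists, and nests of pairs.

private variable
  X Y : Set

-- Positions are natural numbers rather than elements of `Fin`, so that sums of positions need no
-- casts.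
data At {X : Set} : List X → ℕ → X → Set where
  at-zero : ∀ {x xs} → At (x ∷ xs) 0 x
  at-suc  : ∀ {x y i xs} → At xs i x → At (y ∷ xs) (suc i) x

∈⇒At : ∀ {x : X} {xs} → x ∈ xs → ∃ λ i → At xs i x
∈⇒At (here refl) = 0 , at-zero
∈⇒At (there p)   = let i , q = ∈⇒At p in suc i , at-suc q

At-< : ∀ {x : X} {xs i} → At xs i x → i < length xs
At-< at-zero      = z<s
At-< (at-suc p) = s<s (At-< p)

At-++ˡ : ∀ {x : X} {xs ys i} → At xs i x → At (xs ++ ys) i x
At-++ˡ at-zero      = at-zero
At-++ˡ (at-suc p) = at-suc (At-++ˡ p)

At-++ʳ : ∀ {x : X} xs {ys i} → At ys i x → At (xs ++ ys) (length xs + i) x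
At-++ʳ []       p = p
At-++ʳ (_ ∷ xs) p = at-suc (At-++ʳ xs p)

At-map : ∀ (f : X → Y) {x xs i} → At xs i x → At (map f xs) i (f x)
At-map f at-zero      = at-zero
At-map f (at-suc p) = at-suc (At-map f p)

At-reverse : ∀ {x : X} {xs i} → At xs i x → ∃ λ j → suc (i + j) ≡ length xs × At (reverse xs) j x
At-reverse {x = x} {x ∷ xs} at-zero = length xs , refl ,
  subst₂ (λ ys j → At ys j x) (sym (Listₚ.unfold-reverse x xs))
    (trans (+-identityʳ _) (Listₚ.length-reverse xs)) (At-++ʳ (reverse xs) at-zero)
At-reverse {x = x} {y ∷ xs} (at-suc p) =
  let j , eq , q = At-reverse p
  in j , cong suc eq , subst (λ ys → At ys j x) (sym (Listₚ.unfold-reverse y xs)) (At-++ˡ q)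

At⇒lookup : ∀ {x : X} {xs i m} → At xs i x → (eq : m ≡ length xs) →
            ∃ λ (u : Fin m) → toℕ u ≡ i × lookup xs (Fin.cast eq u) ≡ x
At⇒lookup {xs = x ∷ _} at-zero refl = zero , refl , refl
At⇒lookup {xs = _ ∷ xs} (at-suc p) refl =
  let u , eq , eq′ = At⇒lookup p refl in suc u , cong suc eq , eq′

-- Partners lie symmetrically about the centre, so all pairs have the same position sum; `ms` fills
-- the centre with entries that have no partner.
nest : List (X × X) → List X → List X
nest []             ms = ms
nest ((x , y) ∷ ps) ms = x ∷ nest ps ms ∷ʳ y

length-nest : ∀ (ps : List (X × X)) ms → length (nest ps ms) ≡ 2 * length ps + length ms
length-nest []       ms = refl
length-nest ((x , y) ∷ ps) ms = cong suc (begin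
  length (nest ps ms ∷ʳ y)             ≡⟨ Listₚ.length-++ (nest ps ms) ⟩
  length (nest ps ms) + 1              ≡⟨ cong (_+ 1) (length-nest ps ms) ⟩
  2 * length ps + length ms + 1        ≡⟨ arith (length ps) (length ms) ⟩
  length ps + suc (length ps + 0) + length ms ∎)
  where
  open ≡-Reasoning
  arith : ∀ p m → 2 * p + m + 1 ≡ p + suc (p + 0) + m
  arith = solve-∀

nest-middle : ∀ (ps : List (X × X)) {ms x} → x ∈ ms → ∃ λ i → At (nest ps ms) i x
nest-middle []       x∈ms = ∈⇒At x∈ms
nest-middle (p ∷ ps) x∈ms = let i , q = nest-middle ps x∈ms in suc i , at-suc (At-++ˡ q)

nest-pair : ∀ {ps : List (X × X)} {ms x y} → (x , y) ∈ ps →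
            ∃₂ λ i j → At (nest ps ms) i x × At (nest ps ms) j y × suc (i + j) ≡ length (nest ps ms)
nest-pair {ps = (x , y) ∷ ps} {ms} (here refl) =
  0 , suc (length (nest ps ms) + 0) , at-zero , at-suc (At-++ʳ (nest ps ms) at-zero) ,
  cong suc (trans (arith (length (nest ps ms))) (sym (Listₚ.length-++ (nest ps ms))))
  where
  arith : ∀ l → suc (l + 0) ≡ l + 1
  arith = solve-∀
nest-pair {ps = (x , y) ∷ ps} {ms} (there pq) with nest-pair {ms = ms} pq
... | i , j , p , q , eq = suc i , suc j , at-suc (At-++ˡ p) , at-suc (At-++ˡ q) ,
  cong suc (trans (arith i j) (trans (cong (_+ 1) eq) (sym (Listₚ.length-++ (nest ps ms)))))
  where
  arith : ∀ i j → suc (i + suc j) ≡ suc (i + j) + 1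
  arith = solve-∀

-- Layouts of fixed vertices and dominoes.

module Layouts {n} (G : Graph n) where

  open Graph G using (Adj)

  V Domino : Set
  V = Fin n
  Domino = V × V

  side : Bool → Domino → V
  side false = proj₁
  side true  = proj₂

  -- A domino has one vertex in each row. The edges of G between row vertices
  -- are the crosses and, for pair (a , d) (b , c), the three edges of the path
  -- a b c d.
  data Item : Set where
    fixed : V → Item
    spare cross : Domino → Item
    pair : Domino → Domino → Item

  Layout : Set
  Layout = List Item

  data InRow (A : Layout) (c : Bool) : V → Set where
    in-spare : ∀ {e} → spare e ∈ A → InRow A c (side c e)
    in-cross : ∀ {e} → cross e ∈ A → InRow A c (side c e)
    in-pair₁ : ∀ {e f} → pair e f ∈ A → InRow A c (side c e)
    in-pair₂ : ∀ {e f} → pair e f ∈ A → InRow A c (side c f)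

  data Crossing (A : Layout) : Domino → Set where
    of-cross : ∀ {e} → cross e ∈ A → Crossing A e
    of-pair  : ∀ {e f} → pair e f ∈ A → Crossing A f

  data Link (A : Layout) (c : Bool) : Bool → Rel V 0ℓ where
    across   : ∀ {e} → Crossing A e → Link A c (not c) (side c e) (side (not c) e)
    along    : ∀ {e f} → pair e f ∈ A → Link A c c (side c e) (side c f)
    backward : ∀ {e f} → pair e f ∈ A → Link A c c (side c f) (side c e)

  -- One candidate `nbr c` for each row bounds the neighbours in that row by one.
  FixedGood : Layout → V → Set
  FixedGood A x = ∃ λ (nbr : Bool → V) → ∀ {y} → Adj x y → ∃ λ c → y ≡ nbr c × InRow A c y

  Attached : Layout → Bool → V → V → Set
  Attached A c x y = fixed y ∈ A ⊎ ∃ λ c′ → Link A c c′ x y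

  RowGood : Layout → Bool → V → Set
  RowGood A c x = ∀ {y} → Adj x y → Attached A c x y

  Good : Layout → Item → Set
  Good A (fixed x)  = FixedGood A x
  Good A (spare e)  = ∀ c → RowGood A c (side c e)
  Good A (cross e)  = ∀ c → RowGood A c (side c e)
  Good A (pair e f) = ∀ c → RowGood A c (side c e) × RowGood A c (side c f)

  row-good : ∀ {A c x} → All (Good A) A → InRow A c x → RowGood A c x
  row-good good (in-spare p) = All.lookup good p _
  row-good good (in-cross p) = All.lookup good p _
  row-good good (in-pair₁ p) = proj₁ (All.lookup good p _)
  row-good good (in-pair₂ p) = proj₂ (All.lookup good p _)

  fixeds : Layout → List V
  fixeds []             = []
  fixeds (fixed x ∷ A)  = x ∷ fixeds A
  fixeds (spare _ ∷ A)  = fixeds A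
  fixeds (cross _ ∷ A)  = fixeds A
  fixeds (pair _ _ ∷ A) = fixeds A

  spares : Layout → List Domino
  spares []             = []
  spares (fixed _ ∷ A)  = spares A
  spares (spare e ∷ A)  = e ∷ spares A
  spares (cross _ ∷ A)  = spares A
  spares (pair _ _ ∷ A) = spares A

  crosses : Layout → List Domino
  crosses []             = []
  crosses (fixed _ ∷ A)  = crosses A
  crosses (spare _ ∷ A)  = crosses A
  crosses (cross e ∷ A)  = e ∷ crosses A
  crosses (pair _ _ ∷ A) = crosses A

  pairs : Layout → List (Domino × Domino)
  pairs []             = []
  pairs (fixed _ ∷ A)  = pairs A
  pairs (spare _ ∷ A)  = pairs A
  pairs (cross _ ∷ A)  = pairs A
  pairs (pair e f ∷ A) = (e , f) ∷ pairs A

  ∈-fixeds : ∀ {x A} → fixed x ∈ A → x ∈ fixeds A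
  ∈-fixeds                  (here refl) = here refl
  ∈-fixeds {A = fixed _  ∷ _} (there p) = there (∈-fixeds p)
  ∈-fixeds {A = spare _  ∷ _} (there p) = ∈-fixeds p
  ∈-fixeds {A = cross _  ∷ _} (there p) = ∈-fixeds p
  ∈-fixeds {A = pair _ _ ∷ _} (there p) = ∈-fixeds p

  ∈-spares : ∀ {e A} → spare e ∈ A → e ∈ spares A
  ∈-spares                  (here refl) = here refl
  ∈-spares {A = fixed _  ∷ _} (there p) = ∈-spares p
  ∈-spares {A = spare _  ∷ _} (there p) = there (∈-spares p)
  ∈-spares {A = cross _  ∷ _} (there p) = ∈-spares p
  ∈-spares {A = pair _ _ ∷ _} (there p) = ∈-spares p

  ∈-crosses : ∀ {e A} → cross e ∈ A → e ∈ crosses A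
  ∈-crosses                  (here refl) = here refl
  ∈-crosses {A = fixed _  ∷ _} (there p) = ∈-crosses p
  ∈-crosses {A = spare _  ∷ _} (there p) = ∈-crosses p
  ∈-crosses {A = cross _  ∷ _} (there p) = there (∈-crosses p)
  ∈-crosses {A = pair _ _ ∷ _} (there p) = ∈-crosses p

  ∈-pairs : ∀ {e f A} → pair e f ∈ A → (e , f) ∈ pairs A
  ∈-pairs                  (here refl) = here refl
  ∈-pairs {A = fixed _  ∷ _} (there p) = ∈-pairs p
  ∈-pairs {A = spare _  ∷ _} (there p) = ∈-pairs p
  ∈-pairs {A = cross _  ∷ _} (there p) = ∈-pairs p
  ∈-pairs {A = pair _ _ ∷ _} (there p) = there (∈-pairs p)

  -- The rows may list the dominoes in different orders, hence one list `columns c` per row.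
  -- `Across` takes the position in row `false` first.
  record Arrangement (k m : ℕ) (A : Layout) : Set₁ where
    field
      columns : Bool → List Domino
      length-columns : ∀ c → m ≡ length (columns c)
      Across : Rel ℕ 0ℓ
      Along : Bool → Rel ℕ 0ℓ
      spare-at : ∀ {e} → spare e ∈ A → ∀ c → ∃ λ i → At (columns c) i e
      crossing-at : ∀ {e} → Crossing A e →
        ∃₂ λ i j → At (columns false) i e × At (columns true) j e × Across i j
      pair-at : ∀ {e f} → pair e f ∈ A → ∀ c →
        ∃₂ λ i j → At (columns c) i e × At (columns c) j f × Along c i j × Along c j i
      across-free : ConflictFree k m Across
      along-free : ∀ c → ConflictFree k m (Along c)

    Aligned : Bool → Bool → Rel ℕ 0ℓ
    Aligned false false = Along false
    Aligned false true  = Across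
    Aligned true  false = flip Across
    Aligned true  true  = Along true

    aligned-free : ∀ c c′ → ConflictFree k m (Aligned c c′)
    aligned-free false false = along-free false
    aligned-free false true  = across-free
    aligned-free true  false 0<d d<k u< v< u′< v′< r r′ s s′ =
      across-free 0<d d<k v< u< v′< u′< r r′ s′ s
    aligned-free true  true  = along-free true

    Along⇒Aligned : ∀ c {i j} → Along c i j → Aligned c c i j
    Along⇒Aligned false r = r
    Along⇒Aligned true  r = r

    in-row-at : ∀ {c x} → InRow A c x → ∃ λ i → At (map (side c) (columns c)) i x
    in-row-at {c} (in-spare p) = let i , q = spare-at p c in i , At-map (side c) q
    in-row-at {false} (in-cross p) = let i , _ , q , _ = crossing-at (of-cross p) in i , At-map _ q
    in-row-at {true}  (in-cross p) = let _ , j , _ , q , _ = crossing-at (of-cross p) in j , At-map _ q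
    in-row-at {c} (in-pair₁ p) = let i , _ , q , _ = pair-at p c in i , At-map (side c) q
    in-row-at {c} (in-pair₂ p) = let _ , j , _ , q , _ = pair-at p c in j , At-map (side c) q

    link-at : ∀ {c c′ x y} → Link A c c′ x y → ∃₂ λ i j →
      At (map (side c) (columns c)) i x × At (map (side c′) (columns c′)) j y × Aligned c c′ i j
    link-at {false} (across p) =
      let i , j , q , q′ , r = crossing-at p in i , j , At-map _ q , At-map _ q′ , r
    link-at {true} (across p) =
      let i , j , q , q′ , r = crossing-at p in j , i , At-map _ q′ , At-map _ q , r
    link-at {c} (along p) =
      let i , j , q , q′ , r , _ = pair-at p c
      in i , j , At-map (side c) q , At-map (side c) q′ , Along⇒Aligned c r
    link-at {c} (backward p) =
      let i , j , q , q′ , _ , r = pair-at p c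
      in j , i , At-map (side c) q′ , At-map (side c) q , Along⇒Aligned c r

  module _ {k m A} .{{_ : NonZero m}} (arr : Arrangement k m A) (k≤m : k ≤ m)
    (good : All (Good A) A) (covers : ∀ v → fixed v ∈ A ⊎ ∃ λ c → InRow A c v)
    (size : length (fixeds A) + 2 * m ≤ n)
    where

    open Arrangement arr

    private
      length-row : ∀ c → m ≡ length (map (side c) (columns c))
      length-row c = trans (length-columns c) (sym (Listₚ.length-map (side c) (columns c)))

      row : Bool → Fin m → V
      row c u = lookup (map (side c) (columns c)) (Fin.cast (length-row c) u)

      At⇒row : ∀ {c i x} → At (map (side c) (columns c)) i x →
               ∃ λ u → toℕ u ≡ i × row c u ≡ x
      At⇒row {c} p = At⇒lookup p (length-row c)

      fixed-onto : ∀ {x} → fixed x ∈ A → ∃ λ i → lookup (fixeds A) i ≡ x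
      fixed-onto p = index (∈-fixeds p) , sym (lookup-index (∈-fixeds p))

      row-onto : ∀ {c x} → InRow A c x → ∃ λ u → row c u ≡ x
      row-onto p = let _ , q = in-row-at p ; u , _ , eq = At⇒row q in u , eq

      onto : ∀ v → (∃ λ i → lookup (fixeds A) i ≡ v) ⊎ (∃₂ λ c u → row c u ≡ v)
      onto v = Sum.map fixed-onto (λ (c , p) → c , row-onto p) (covers v)

      open module Rot = Rotating G k≤m (lookup (fixeds A)) row onto size using (at-injective)

      fixed≢row : ∀ i {c u} → lookup (fixeds A) i ≢ row c u
      fixed≢row i {c} {u} eq with () ← at-injective {inj₁ i} {inj₂ (c , u)} eq

      row-injective : ∀ {c u c′ u′} → row c u ≡ row c′ u′ → (c , u) ≡ (c′ , u′)
      row-injective {c} {u} {c′} {u′} eq =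
        inj₂-injective (at-injective {inj₂ (c , u)} {inj₂ (c′ , u′)} eq)

      fixed-item : ∀ i → fixed (lookup (fixeds A) i) ∈ A
      fixed-item i with covers (lookup (fixeds A) i)
      ... | inj₁ p = p
      ... | inj₂ (c , p) = contradiction (sym (proj₂ (row-onto p))) (fixed≢row i)

      same-row : ∀ {c u c′} → InRow A c′ (row c u) → c′ ≡ c
      same-row p = ,-injectiveˡ (row-injective (proj₂ (row-onto p)))

      row-item : ∀ c u → InRow A c (row c u)
      row-item c u with covers (row c u)
      ... | inj₁ p = contradiction (proj₂ (fixed-onto p)) (fixed≢row _)
      ... | inj₂ (c′ , p) = subst (λ c → InRow A c _) (same-row p) p

      independent : ∀ i j → ¬ Adj (lookup (fixeds A) i) (lookup (fixeds A) j)
      independent i j adj =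
        let _ , nbr-is = All.lookup good (fixed-item i)
            _ , _ , p = nbr-is adj
        in fixed≢row j (sym (proj₂ (row-onto p)))

      one-per-row : ∀ i c {u u′} → Adj (lookup (fixeds A) i) (row c u) →
                    Adj (lookup (fixeds A) i) (row c u′) → u ≡ u′
      one-per-row i c {u} {u′} adj adj′ =
        let nbr , nbr-is = All.lookup good (fixed-item i)
            c₁ , eq₁ , p₁ = nbr-is adj
            c₂ , eq₂ , p₂ = nbr-is adj′
        in proj₂ (,-injective (row-injective (trans eq₁
             (trans (cong nbr (trans (same-row p₁) (sym (same-row p₂)))) (sym eq₂)))))

      row-edges : ∀ {c c′ u u′} → Adj (row c u) (row c′ u′) → Aligned c c′ (toℕ u) (toℕ u′)
      row-edges {c} {c′} {u} {u′} adj with row-good good (row-item c u) adj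
      ... | inj₁ p = contradiction (proj₂ (fixed-onto p)) (fixed≢row _)
      ... | inj₂ (c″ , link) with link-at link
      ... | i , j , at₁ , at₂ , r with At⇒row at₁ | At⇒row at₂
      ... | w , refl , eq | w′ , refl , eq′ with row-injective eq | row-injective eq′
      ... | refl | refl = r

    layout-placeable : Placeable G k
    layout-placeable = Rot.placeable Aligned independent one-per-row row-edges aligned-free

-- Position sums under rotation.

-- For linear arithmetic: `c ≡ d` is a combination of the hypotheses, and the last argument is an
-- identity for the ring solver. In `lin-≤`, `s` is the slack.
lin-≡ : ∀ {a b c d} → c ≡ d → a + d ≡ b + c → a ≡ b
lin-≡ {a} {b} {c} refl eq = +-cancelʳ-≡ c a b eq

lin-≤ : ∀ {a b c d} s → c ≤ d → a + d + s ≡ b + c → a ≤ b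
lin-≤ {a} {b} {c} {d} s c≤d eq = +-cancelʳ-≤ d a b
  (≤-trans (m≤m+n (a + d) s) (≤-trans (≤-reflexive eq) (+-monoʳ-≤ b c≤d)))

-- `w` counts how many of the two positions wrap around.
steps-sum : ∀ {m d u v u′ v′} → Step m d u u′ → Step m d v v′ →
            ∃ λ w → w ≤ 2 × (u + v) + 2 * d ≡ (u′ + v′) + w * m
steps-sum {m} {d} {u} {v} {u′} {v′} s s′ = combine s s′
  where
  regroup : ∀ u v d → (u + v) + 2 * d ≡ (u + d) + (v + d)
  regroup = solve-∀
  combine : Step m d u u′ → Step m d v v′ → ∃ λ w → w ≤ 2 × (u + v) + 2 * d ≡ (u′ + v′) + w * m
  combine (inj₁ p) (inj₁ q) = 0 , z≤n , trans (regroup u v d) (trans (cong₂ _+_ p q) (reorder u′ v′ m))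
    where reorder : ∀ x y m → x + y ≡ x + y + 0 * m
          reorder = solve-∀
  combine (inj₁ p) (inj₂ q) = 1 , s≤s z≤n , trans (regroup u v d) (trans (cong₂ _+_ p q) (reorder u′ v′ m))
    where reorder : ∀ x y m → x + (y + m) ≡ x + y + 1 * m
          reorder = solve-∀
  combine (inj₂ p) (inj₁ q) = 1 , s≤s z≤n , trans (regroup u v d) (trans (cong₂ _+_ p q) (reorder u′ v′ m))
    where reorder : ∀ x y m → x + m + y ≡ x + y + 1 * m
          reorder = solve-∀
  combine (inj₂ p) (inj₂ q) = 2 , ≤-refl , trans (regroup u v d) (trans (cong₂ _+_ p q) (reorder u′ v′ m))
    where reorder : ∀ x y m → x + m + (y + m) ≡ x + y + 2 * m
          reorder = solve-∀

-- Equal sums leave 2 d = w m with w ≤ 2; w = 0 would mean d = 0 and w = 2 would mean d = m.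
equal-sums⇒half-turn : ∀ {m d u v u′ v′} → 0 < d → d < m → u + v ≡ u′ + v′ →
                       Step m d u u′ → Step m d v v′ → 2 * d ≡ m
equal-sums⇒half-turn {m} {d} {u} {v} {u′} {v′} 0<d d<m eq s s′ = cases (steps-sum {u = u} {v} s s′)
  where
  cases : (∃ λ w → w ≤ 2 × (u + v) + 2 * d ≡ (u′ + v′) + w * m) → 2 * d ≡ m
  cases (w , w≤2 , eq′) = turns w w≤2 (+-cancelˡ-≡ (u + v) (2 * d) (w * m)
    (trans eq′ (cong (_+ w * m) (sym eq))))
    where
    turns : ∀ w → w ≤ 2 → 2 * d ≡ w * m → 2 * d ≡ m
    turns 0 _ e = contradiction 0<d (≤⇒≯ (≤-reflexive (*-cancelˡ-≡ d 0 2 e)))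
    turns 1 _ e = trans e (*-identityˡ m)
    turns 2 _ e = contradiction d<m (≤⇒≯ (≤-reflexive (sym (*-cancelˡ-≡ d m 2 e))))
    turns (suc (suc (suc _))) (s≤s (s≤s ()))

Facing : ℕ → Rel ℕ 0ℓ
Facing m i j = suc (i + j) ≡ m

-- Rotating by d changes the sum of two opposite positions by 2 d.
facing-free : ∀ {k m} → k ≤ m → (∀ {d} → d < k → 2 * d ≢ m) → ConflictFree k m (Facing m)
facing-free k≤m no-half {u = u} {v} 0<d d<k _ _ _ _ r r′ s s′ = no-half d<k
  (equal-sums⇒half-turn {u = u} {v} 0<d (<-≤-trans d<k k≤m) (suc-injective (trans r (sym r′))) s s′)

-- A row of length 2 h < 2 k can be rotated by h, which preserves position sums.
-- No vertex stays in its half of the row then, and edges from different halves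
-- are kept apart by the parities of a and b.
Split : ℕ → ℕ → ℕ → Rel ℕ 0ℓ
Split h a b i j = (i < h × 2 + (i + j) ≡ a) ⊎ (h ≤ i × 2 + (i + j) ≡ b)

split-free : ∀ {k h a b t} → k ≤ 2 * h → a + b ≡ suc (2 * t) → ConflictFree k (2 * h) (Split h a b)
split-free {k} {h} {a} {b} {t} k≤m a+b {d} {u} {v} {u′} {v′} 0<d d<k u<m _ u′<m _ r r′ s s′ = go r r′
  where
  same-sum : u + v ≡ u′ + v′ → u + h ≡ u′ ⊎ u + h ≡ u′ + 2 * h
  same-sum eq = subst (λ d → Step (2 * h) d u u′)
    (*-cancelˡ-≡ d h 2 (equal-sums⇒half-turn {u = u} {v} 0<d (<-≤-trans d<k k≤m) eq s s′)) s
  -- As the row length is even, rotation keeps the parity of a position sum, whereas `a + b` is odd.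
  mixed : (u + v) + (u′ + v′) + 4 ≡ a + b → ⊥
  mixed eq with steps-sum {u = u} {v} s s′
  ... | w , _ , eq′ = even≢odd (u′ + v′ + w * h + 2) (t + d) (sym (begin
      suc (2 * (t + d))                          ≡⟨ l₁ t d ⟩
      suc (2 * t) + 2 * d                        ≡⟨ cong (_+ 2 * d) (trans (sym a+b) (sym eq)) ⟩
      (u + v) + (u′ + v′) + 4 + 2 * d            ≡⟨ l₂ (u + v) (u′ + v′) (2 * d) ⟩
      ((u + v) + 2 * d) + ((u′ + v′) + 4)        ≡⟨ cong (_+ (u′ + v′ + 4)) eq′ ⟩
      (u′ + v′) + w * (2 * h) + ((u′ + v′) + 4)  ≡⟨ l₃ (u′ + v′) w h ⟩
      2 * (u′ + v′ + w * h + 2)                  ∎))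
    where
    open ≡-Reasoning
    l₁ : ∀ t d → suc (2 * (t + d)) ≡ suc (2 * t) + 2 * d
    l₁ = solve-∀
    l₂ : ∀ x y z → x + y + 4 + z ≡ (x + z) + (y + 4)
    l₂ = solve-∀
    l₃ : ∀ x w h → x + w * (2 * h) + (x + 4) ≡ 2 * (x + w * h + 2)
    l₃ = solve-∀
  from-2+ : ∀ {c} → 2 + (u + v) ≡ c → 2 + (u′ + v′) ≡ c → u + v ≡ u′ + v′
  from-2+ p q = suc-injective (suc-injective (trans p (sym q)))
  2h : ∀ u h → u + 2 * h ≡ u + h + h
  2h = solve-∀
  add : ∀ x y → x + y + 4 ≡ (2 + x) + (2 + y)
  add = solve-∀
  go : Split h a b u v → Split h a b u′ v′ → ⊥
  go (inj₁ (u<h , p)) (inj₁ (u′<h , p′)) with same-sum (from-2+ p p′)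
  ... | inj₁ eq = <⇒≱ u′<h (subst (h ≤_) eq (m≤n+m h u))
  ... | inj₂ eq = <⇒≱ u<h (subst (h ≤_) (sym (+-cancelʳ-≡ h u (u′ + h) (trans eq (2h u′ h)))) (m≤n+m h u′))
  go (inj₂ (h≤u , p)) (inj₂ (h≤u′ , p′)) with same-sum (from-2+ p p′)
  ... | inj₁ eq = <⇒≱ u′<m (subst₂ _≤_ (sym (2h 0 h)) eq (+-monoˡ-≤ h h≤u))
  ... | inj₂ eq = <⇒≱ u<m (subst₂ _≤_ (sym (2h 0 h))
                    (sym (+-cancelʳ-≡ h u (u′ + h) (trans eq (2h u′ h)))) (+-monoˡ-≤ h h≤u′))
  go (inj₁ (_ , p)) (inj₂ (_ , q)) = mixed (trans (add (u + v) (u′ + v′)) (cong₂ _+_ p q))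
  go (inj₂ (_ , p)) (inj₁ (_ , q)) = mixed (trans (add (u + v) (u′ + v′)) (trans (cong₂ _+_ p q) (+-comm b a)))

-- Ordering the dominoes in the two rows.

module _ {X : Set} where

  splitAt-length : ∀ l (ms : List X) → l ≤ length ms →
                   ∃₂ λ ms₁ ms₂ → ms ≡ ms₁ ++ ms₂ × length ms₁ ≡ l
  splitAt-length zero    ms       _         = [] , ms , refl , refl
  splitAt-length (suc l) (x ∷ ms) (s≤s l≤) with splitAt-length l ms l≤
  ... | ms₁ , ms₂ , refl , refl = x ∷ ms₁ , ms₂ , refl , refl

  private
    two-more : ∀ p m → 2 * suc p + m ≡ 2 + (2 * p + m)
    two-more = solve-∀

  -- Whole pairs are taken as long as they fit. If a single place remains, it is filled from `ms`,
  -- which therefore must not be empty.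
  nest-split : ∀ h (ps : List (X × X)) (ms : List X) → 0 < length ms → h ≤ 2 * length ps + length ms →
               ∃₂ λ ps₁ ps₂ → ∃₂ λ (ms₁ ms₂ : List X) → ps ≡ ps₁ ++ ps₂ × ms ≡ ms₁ ++ ms₂ ×
               2 * length ps₁ + length ms₁ ≡ h
  nest-split h [] ms _ h≤ with splitAt-length h ms h≤
  ... | ms₁ , ms₂ , eq , len = [] , [] , ms₁ , ms₂ , refl , eq , len
  nest-split 0 ps ms _ _ = [] , ps , [] , ms , refl , refl , refl
  nest-split 1 ps (x ∷ ms) _ _ = [] , ps , [ x ] , ms , refl , refl , refl
  nest-split (suc (suc h)) (p ∷ ps) ms nonempty h≤ =
    let ps₁ , ps₂ , ms₁ , ms₂ , eq , eq′ , len = nest-split h ps ms nonempty h≤′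
    in p ∷ ps₁ , ps₂ , ms₁ , ms₂ , cong (p ∷_) eq , eq′ ,
       trans (two-more (length ps₁) (length ms₁)) (cong (2 +_) len)
    where
    h≤′ : h ≤ 2 * length ps + length ms
    h≤′ = +-cancelˡ-≤ 2 _ _ (≤-trans h≤ (≤-reflexive (two-more (length ps) (length ms))))

module Arranging {n} (G : Graph n) where
  open Layouts G

  width : Layout → ℕ
  width A = 2 * length (pairs A) + (length (crosses A) + length (spares A))

  -- Row true lists the dominoes backwards, so that the two halves of a domino
  -- face each other just like the partners in a nest do.
  facing-arrangement : ∀ {k} A → (let m = width A) → k ≤ m →
    (∀ {d} → d < k → 2 * d ≢ m) → Arrangement k m A
  facing-arrangement {k} A k≤m no-half = record
    { columns = columns
    ; length-columns = λ { false → length-D ; true → trans length-D (sym (Listₚ.length-reverse D)) }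
    ; Across = Facing m
    ; Along = λ _ → Facing m
    ; spare-at = λ p c → column-at c (nest-middle (pairs A) (∈-++⁺ʳ (crosses A) (∈-spares p)))
    ; crossing-at = λ p → crossing (crossing-position p)
    ; pair-at = λ p → paired (nest-pair (∈-pairs p))
    ; across-free = facing-free k≤m no-half
    ; along-free = λ _ → facing-free k≤m no-half
    }
    where
    m = width A
    ms = crosses A ++ spares A
    D = nest (pairs A) ms
    columns : Bool → List Domino
    columns false = D
    columns true  = reverse D
    length-D : m ≡ length D
    length-D = trans (cong (2 * length (pairs A) +_) (sym (Listₚ.length-++ (crosses A))))
                 (sym (length-nest (pairs A) ms))
    column-at : ∀ c {e} → (∃ λ i → At D i e) → ∃ λ i → At (columns c) i e
    column-at false p = p
    column-at true (_ , p) = let j , _ , q = At-reverse p in j , q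
    crossing-position : ∀ {e} → Crossing A e → ∃ λ i → At D i e
    crossing-position (of-cross p) = nest-middle (pairs A) (∈-++⁺ˡ (∈-crosses p))
    crossing-position (of-pair p) = let _ , j , _ , q , _ = nest-pair {ms = ms} (∈-pairs p) in j , q
    crossing : ∀ {e} → (∃ λ i → At D i e) →
      ∃₂ λ i j → At D i e × At (reverse D) j e × Facing m i j
    crossing (i , p) = let j , eq , q = At-reverse p in i , j , p , q , trans eq (sym length-D)
    facing-sym : ∀ i j → Facing m i j → Facing m j i
    facing-sym i j eq = trans (cong suc (+-comm j i)) eq
    reflected : ∀ i i* j j* l → suc (i + i*) ≡ l → suc (j + j*) ≡ l → suc (i + j) ≡ l → suc (i* + j*) ≡ l
    reflected i i* j j* l p q r =
      lin-≡ (cong₂ _+_ (cong₂ _+_ p q) (sym r)) (shuffle i i* j j* l)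
      where
      shuffle : ∀ i i* j j* l → suc (i* + j*) + (l + l + suc (i + j)) ≡ l + (suc (i + i*) + suc (j + j*) + l)
      shuffle = solve-∀
    paired : ∀ {e f} → (∃₂ λ i j → At D i e × At D j f × suc (i + j) ≡ length D) → ∀ c →
      ∃₂ λ i j → At (columns c) i e × At (columns c) j f × Facing m i j × Facing m j i
    paired (i , j , p , q , eq) false =
      i , j , p , q , trans eq (sym length-D) , facing-sym i j (trans eq (sym length-D))
    paired (i , j , p , q , eq) true =
      let i* , eqi , p* = At-reverse p
          j* , eqj , q* = At-reverse q
          eq* = trans (reflected i i* j j* _ eqi eqj eq) (sym length-D)
      in i* , j* , p* , q* , eq* , facing-sym i* j* eq*

  module _ {A : Layout} {s rest} (spares≡ : spares A ≡ s ∷ rest)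
    (ps₁ ps₂ : List (Domino × Domino)) (ms₁ ms₂ : List Domino)
    (pairs≡ : pairs A ≡ ps₁ ++ ps₂) (middle≡ : crosses A ++ rest ≡ ms₁ ++ ms₂)
    where

    private
      D₁ D₂ : List Domino
      D₁ = nest ps₁ ms₁
      D₂ = nest ps₂ ms₂

      h : ℕ
      h = length D₁

      columns : Bool → List Domino
      columns false = D₁ ++ D₂ ++ [ s ]
      columns true  = reverse (D₁ ++ s ∷ D₂)

      Half : (List Domino → Set) → Set
      Half P = P D₁ ⊎ P D₂

      middle-position : ∀ {e} → e ∈ crosses A ++ rest → Half λ D → ∃ λ i → At D i e
      middle-position p = Sum.map (nest-middle ps₁) (nest-middle ps₂)
        (∈-++⁻ ms₁ (subst (_ ∈_) middle≡ p))

      pair-position : ∀ {e f} → pair e f ∈ A →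
        Half λ D → ∃₂ λ i j → At D i e × At D j f × suc (i + j) ≡ length D
      pair-position p = Sum.map nest-pair nest-pair (∈-++⁻ ps₁ (subst (_ ∈_) pairs≡ (∈-pairs p)))

      crossing-position : ∀ {e} → Crossing A e → Half λ D → ∃ λ i → At D i e
      crossing-position (of-cross p) = middle-position (∈-++⁺ˡ (∈-crosses p))
      crossing-position (of-pair p) with pair-position p
      ... | inj₁ (_ , j , _ , q , _) = inj₁ (j , q)
      ... | inj₂ (_ , j , _ , q , _) = inj₂ (j , q)

    -- The spare `s` ends row `false` but separates the two nests in row `true`; this lowers the
    -- across sums of `D₂` by one against those of `D₁`. Along a row the parities differ because the
    -- nests have lengths h and h - 1. In all three cases the two sums, taken with positions counted
    -- from 1, add up to 4 h + 1.
    split-arrangement : ∀ {k} → suc (length D₂) ≡ h → k ≤ 2 * h → Arrangement k (2 * h) A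
    split-arrangement {k} len₂ k≤ = record
      { columns = columns
      ; length-columns = λ { false → trans length-D⁰ (sym (Listₚ.length-++ D₁))
                           ; true → trans length-D¹ (sym (Listₚ.length-reverse (D₁ ++ s ∷ D₂))) }
      ; Across = Split h (2 * h + 1) (2 * h)
      ; Along = Aligned
      ; spare-at = λ p c → spare-position c (∈-spares p)
      ; crossing-at = λ p → crossing (crossing-position p)
      ; pair-at = λ p → paired (pair-position p)
      ; across-free = split-free {h = h} {t = 2 * h} k≤ (odd₁ h)
      ; along-free = λ { false → split-free {h = h} {t = 2 * h} k≤ (odd₂ h)
                        ; true → split-free {h = h} {t = 2 * h} k≤ (odd₃ h) }
      }
      where
      -- The sum for the lower half comes first. In row `true` it belongs to `D₂`, because reversal
      -- exchanges the halves.
      Aligned : Bool → Rel ℕ 0ℓ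
      Aligned false = Split h (h + 1) (3 * h)
      Aligned true  = Split h h (3 * h + 1)
      odd₁ : ∀ h → 2 * h + 1 + 2 * h ≡ suc (2 * (2 * h))
      odd₁ = solve-∀
      odd₂ : ∀ h → h + 1 + 3 * h ≡ suc (2 * (2 * h))
      odd₂ = solve-∀
      odd₃ : ∀ h → h + (3 * h + 1) ≡ suc (2 * (2 * h))
      odd₃ = solve-∀
      length-D⁰ : 2 * h ≡ h + length (D₂ ++ [ s ])
      length-D⁰ = cong (h +_) (trans (+-identityʳ h) (trans (sym len₂)
        (trans (+-comm 1 _) (sym (Listₚ.length-++ D₂)))))
      length-D¹ : 2 * h ≡ length (D₁ ++ s ∷ D₂)
      length-D¹ = trans (cong (h +_) (trans (+-identityʳ h) (sym len₂))) (sym (Listₚ.length-++ D₁))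
      turned : ∀ {i e} → At (D₁ ++ s ∷ D₂) i e →
               ∃ λ j → suc (i + j) ≡ 2 * h × At (columns true) j e
      turned p = let j , eq , q = At-reverse p in j , trans eq (sym length-D¹) , q
      in-column : ∀ {e} c → Half (λ D → ∃ λ i → At D i e) → ∃ λ i → At (columns c) i e
      in-column false (inj₁ (_ , p)) = _ , At-++ˡ p
      in-column false (inj₂ (_ , p)) = _ , At-++ʳ D₁ (At-++ˡ p)
      in-column true  (inj₁ (_ , p)) = let j , _ , q = turned (At-++ˡ p) in j , q
      in-column true  (inj₂ (_ , p)) = let j , _ , q = turned (At-++ʳ D₁ (at-suc p)) in j , q
      spare-position : ∀ c {e} → e ∈ spares A → ∃ λ i → At (columns c) i e
      spare-position c p with subst (_ ∈_) spares≡ p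
      spare-position false _ | here refl = _ , At-++ʳ D₁ (At-++ʳ D₂ at-zero)
      spare-position true _ | here refl = let j , _ , q = turned (At-++ʳ D₁ at-zero) in j , q
      spare-position c _ | there q = in-column c (middle-position (∈-++⁺ʳ (crosses A) q))
      crossing : ∀ {e} → Half (λ D → ∃ λ i → At D i e) →
        ∃₂ λ i j → At (columns false) i e × At (columns true) j e × Split h (2 * h + 1) (2 * h) i j
      crossing (inj₁ (i , p)) =
        let j , eq , q = turned (At-++ˡ p)
        in i , j , At-++ˡ p , q , inj₁ (At-< p , trans (cong suc eq) (+-comm 1 _))
      crossing (inj₂ (i , p)) =
        let j , eq , q = turned (At-++ʳ D₁ (at-suc p))
        in h + i , j , At-++ʳ D₁ (At-++ˡ p) , q , inj₂ (m≤m+n h i , trans (l h i j) eq)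
        where
        l : ∀ h i j → 2 + (h + i + j) ≡ suc (h + suc i + j)
        l = solve-∀
      upper : ∀ {i i*} → i < h → suc (i + i*) ≡ 2 * h → h ≤ i*
      upper {i} {i*} i<h eq = lin-≤ 0 (+-mono-≤ i<h (≤-reflexive (sym eq))) (l i i* h)
        where
        l : ∀ i i* h → h + (h + suc (i + i*)) + 0 ≡ i* + (suc i + 2 * h)
        l = solve-∀
      lower : ∀ {i i*} → suc (h + suc i + i*) ≡ 2 * h → i* < h
      lower {i} {i*} eq = lin-≤ (suc i) (≤-reflexive eq) (l h i i*)
        where
        l : ∀ h i i* → suc i* + 2 * h + suc i ≡ h + suc (h + suc i + i*)
        l = solve-∀
      sum-upper : ∀ i j i* j* h → suc (i + i*) ≡ 2 * h → suc (j + j*) ≡ 2 * h → suc (i + j) ≡ h →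
                  2 + (i* + j*) ≡ 3 * h + 1
      sum-upper i j i* j* h p q r = lin-≡ (cong₂ _+_ (cong₂ _+_ p q) (sym r)) (l i j i* j* h)
        where
        l : ∀ i j i* j* h → 2 + (i* + j*) + (2 * h + 2 * h + suc (i + j))
                          ≡ 3 * h + 1 + (suc (i + i*) + suc (j + j*) + h)
        l = solve-∀
      sum-lower : ∀ i j i* j* h → suc (h + suc i + i*) ≡ 2 * h → suc (h + suc j + j*) ≡ 2 * h →
                  2 + (i + j) ≡ h → 2 + (i* + j*) ≡ h
      sum-lower i j i* j* h p q r = lin-≡ (cong₂ _+_ (cong₂ _+_ p q) (sym r)) (l i j i* j* h)
        where
        l : ∀ i j i* j* h → 2 + (i* + j*) + (2 * h + 2 * h + (2 + (i + j)))
                          ≡ h + (suc (h + suc i + i*) + suc (h + suc j + j*) + h)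
        l = solve-∀
      both : ∀ {c i j} → (i < h × j < h × 2 + (i + j) ≡ c) → ∀ {b} → Split h c b i j × Split h c b j i
      both {c} {i} {j} (i< , j< , eq) = inj₁ (i< , eq) , inj₁ (j< , trans (cong (2 +_) (+-comm j i)) eq)
      both′ : ∀ {c i j} → (h ≤ i × h ≤ j × 2 + (i + j) ≡ c) → ∀ {a} → Split h a c i j × Split h a c j i
      both′ {c} {i} {j} (i≥ , j≥ , eq) = inj₂ (i≥ , eq) , inj₂ (j≥ , trans (cong (2 +_) (+-comm j i)) eq)
      paired : ∀ {e f} → Half (λ D → ∃₂ λ i j → At D i e × At D j f × suc (i + j) ≡ length D) → ∀ c →
        ∃₂ λ i j → At (columns c) i e × At (columns c) j f × Aligned c i j × Aligned c j i
      paired (inj₁ (i , j , p , q , eq)) false =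
        i , j , At-++ˡ p , At-++ˡ q , both (At-< p , At-< q , trans (cong suc eq) (+-comm 1 h))
      paired (inj₂ (i , j , p , q , eq)) false =
        h + i , h + j , At-++ʳ D₁ (At-++ˡ p) , At-++ʳ D₁ (At-++ˡ q) ,
        both′ (m≤m+n h i , m≤m+n h j , trans (l h i j) (cong (λ x → h + (h + x))
          (trans (cong suc eq) (trans len₂ (sym (+-identityʳ h))))))
        where
        l : ∀ h i j → 2 + (h + i + (h + j)) ≡ h + (h + (2 + (i + j)))
        l = solve-∀
      paired (inj₁ (i , j , p , q , eq)) true =
        let i* , eqi , p* = turned (At-++ˡ p)
            j* , eqj , q* = turned (At-++ˡ q)
        in i* , j* , p* , q* , both′ (upper (At-< p) eqi , upper (At-< q) eqj , sum-upper i j i* j* h eqi eqj eq)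
      paired (inj₂ (i , j , p , q , eq)) true =
        let i* , eqi , p* = turned (At-++ʳ D₁ (at-suc p))
            j* , eqj , q* = turned (At-++ʳ D₁ (at-suc q))
        in i* , j* , p* , q* , both (lower eqi , lower eqj , sum-lower i j i* j* h eqi eqj (trans (cong suc eq) len₂))

  -- The balance gives z ≤ 2 m + 1, hence n ≤ 4 m + 1. For m < k this is at most 4 k - 3, which is
  -- below 6 k - 4 once k ≥ 2.
  k≤width : ∀ {k} A → 2 ≤ k →
    length (fixeds A) ≤ length (crosses A) + 2 * length (spares A) + length (pairs A) + 1 →
    6 * k ≤ length (fixeds A) + 2 * width A + 4 → k ≤ width A
  k≤width {k} A 2≤k z≤ 6k≤ = ≮⇒≥ λ m<k → <⇒≱ 2≤k
    (*-cancelˡ-≤ 2 (lin-≤ (e + 3 * q + 1) (+-mono-≤ (+-mono-≤ z≤ 6k≤) (*-monoʳ-≤ 4 m<k)) (l k z e r q)))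
    where
    z = length (fixeds A)
    e = length (crosses A)
    r = length (spares A)
    q = length (pairs A)
    l : ∀ k z e r q →
      2 * k + (e + 2 * r + q + 1 + (z + 2 * (2 * q + (e + r)) + 4) + 4 * k) + (e + 3 * q + 1) ≡
      2 * 1 + (z + 6 * k + 4 * suc (2 * q + (e + r)))
    l = solve-∀

  -- From 3 m + 6 = 6 h + 6 ≤ 6 k one gets z ≥ m + 2, and the balance turns this into r ≥ q + 1. A
  -- bound on n smaller by one would leave only r ≥ q.
  spare-exists : ∀ k h z e r q → h < k → 2 * h ≡ 2 * q + (e + r) → z ≤ e + 2 * r + q + 1 →
                 6 * k ≤ z + 2 * (2 * q + (e + r)) + 4 → 0 < r
  spare-exists k h z e r q h<k 2h≡m z≤ 6k≤ = lin-≤ q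
    (+-mono-≤ (+-mono-≤ z≤ 6k≤) (+-mono-≤ (*-monoʳ-≤ 6 h<k) (*-monoʳ-≤ 3 (≤-reflexive (sym 2h≡m)))))
    (l k h z e r q)
    where
    l : ∀ k h z e r q →
      1 + (e + 2 * r + q + 1 + (z + 2 * (2 * q + (e + r)) + 4) + (6 * k + 3 * (2 * h))) + q ≡
      r + (z + 6 * k + (6 * suc h + 3 * (2 * q + (e + r))))
    l = solve-∀

  arrangement : ∀ {k} A → k ≤ width A →
    length (fixeds A) ≤ length (crosses A) + 2 * length (spares A) + length (pairs A) + 1 →
    6 * k ≤ length (fixeds A) + 2 * width A + 4 → Arrangement k (width A) A
  arrangement {k} A k≤m z≤ 6k≤ with anyUpTo? (λ d → 2 * d ≟ width A) k
  ... | no none = facing-arrangement A k≤m (λ d<k eq → none (_ , d<k , eq))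
  ... | yes (h , h<k , 2h≡m) = with-spare (spares A) refl
    where
    e = length (crosses A)
    q = length (pairs A)
    with-spare : ∀ ss → spares A ≡ ss → Arrangement k (width A) A
    with-spare [] eq = contradiction
      (subst (λ ss → 0 < length ss) eq
        (spare-exists k h (length (fixeds A)) e (length (spares A)) q h<k 2h≡m z≤ 6k≤))
      (<-irrefl refl)
    with-spare (s ∷ rest) eq =
      let ps₁ , ps₂ , ms₁ , ms₂ , pairs≡ , middle≡ , len₁ = nest-split h (pairs A) ms (ms-nonempty ms refl) h≤
          half₁ = trans (length-nest ps₁ ms₁) len₁
          half₂ = trans (cong suc (length-nest ps₂ ms₂)) (rest-half ps₁ ps₂ ms₁ ms₂ pairs≡ middle≡ len₁)
          whole = trans (cong (2 *_) half₁) 2h≡m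
      in subst (λ m → Arrangement k m A) whole
           (split-arrangement eq ps₁ ps₂ ms₁ ms₂ pairs≡ middle≡ (trans half₂ (sym half₁))
             (subst (k ≤_) (sym whole) k≤m))
      where
      ms = crosses A ++ rest
      total : suc (2 * q + length ms) ≡ 2 * h
      total = begin
        suc (2 * q + length ms)          ≡⟨ cong (λ l → suc (2 * q + l)) (Listₚ.length-++ (crosses A)) ⟩
        suc (2 * q + (e + length rest))  ≡⟨ l q e (length rest) ⟩
        2 * q + (e + suc (length rest))  ≡⟨ cong (λ ss → 2 * q + (e + length ss)) eq ⟨
        width A                          ≡⟨ 2h≡m ⟨
        2 * h                            ∎
        where
        open ≡-Reasoning
        l : ∀ q e r → suc (2 * q + (e + r)) ≡ 2 * q + (e + suc r)
        l = solve-∀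
      -- If `ms` were empty, `total` would equate the odd 1 + 2 q with 2 h.
      ms-nonempty : ∀ ms′ → ms ≡ ms′ → 0 < length ms′
      ms-nonempty [] eq′ = contradiction
        (trans (sym total) (cong suc (trans (cong (λ l → 2 * q + length l) eq′) (+-identityʳ (2 * q)))))
        (even≢odd h q)
      ms-nonempty (_ ∷ _) _ = z<s
      below-double : ∀ h {x} → suc x ≡ 2 * h → h ≤ x
      below-double (suc h) {x} eq′ = lin-≤ h (≤-reflexive (sym eq′)) (l h x)
        where
        l : ∀ h x → suc h + suc x + h ≡ x + 2 * suc h
        l = solve-∀
      h≤ : h ≤ 2 * q + length ms
      h≤ = below-double h total
      rest-half : ∀ ps₁ ps₂ ms₁ ms₂ → pairs A ≡ ps₁ ++ ps₂ → ms ≡ ms₁ ++ ms₂ →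
        2 * length ps₁ + length ms₁ ≡ h → suc (2 * length ps₂ + length ms₂) ≡ h
      rest-half ps₁ ps₂ ms₁ ms₂ pairs≡ middle≡ len₁ =
        lin-≡ (cong₂ _+_ sums (sym len₁)) (l (length ps₁) (length ps₂) (length ms₁) (length ms₂) h)
        where
        sums : suc (2 * (length ps₁ + length ps₂) + (length ms₁ + length ms₂)) ≡ 2 * h
        sums = trans (cong suc (cong₂ (λ x y → 2 * x + y)
          (trans (sym (Listₚ.length-++ ps₁)) (cong length (sym pairs≡)))
          (trans (sym (Listₚ.length-++ ms₁)) (cong length (sym middle≡))))) total
        l : ∀ a b c d h → suc (2 * b + d) + (2 * h + (2 * a + c)) ≡
                          h + (suc (2 * (a + b) + (c + d)) + h)
        l = solve-∀

  good-layout⇒placeable : ∀ {k} A → 2 ≤ k → All (Good A) A →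
    (∀ v → fixed v ∈ A ⊎ ∃ λ c → InRow A c v) →
    length (fixeds A) + 2 * width A ≡ n → 6 * k ∸ 4 ≤ n →
    length (fixeds A) ≤ length (crosses A) + 2 * length (spares A) + length (pairs A) + 1 →
    Placeable G k
  good-layout⇒placeable {k} A 2≤k good covers size 6k-4≤n z≤ =
    layout-placeable {{>-nonZero (≤-trans (≤-trans z<s 2≤k) k≤m)}}
      (arrangement A k≤m z≤ 6k≤) k≤m good covers (≤-reflexive size)
    where
    6k≤ : 6 * k ≤ length (fixeds A) + 2 * width A + 4
    6k≤ = subst (λ l → 6 * k ≤ l + 4) (sym size)
      (≤-trans (m≤n+m∸n (6 * k) 4) (≤-trans (+-monoʳ-≤ 4 6k-4≤n) (≤-reflexive (+-comm 4 n))))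
    k≤m : k ≤ width A
    k≤m = k≤width A 2≤k z≤ 6k≤

-- Cutting closed walks into blocks.

first last : X → List X → X
first x []      = x
first _ (y ∷ _) = y
last x []       = x
last _ (y ∷ ys) = last y ys

last-∈ : ∀ (x : X) ys → last x ys ∈ x ∷ ys
last-∈ x []       = here refl
last-∈ x (y ∷ ys) = there (last-∈ y ys)

module Chunking {n} (G : Graph n) where
  open Graph G using (Adj)
  open Layouts G
  open Arranging G

  -- Neither `a` nor `b` has to be a neighbour, and they may coincide; this lets a path pass for a
  -- cycle.
  Only : V → V → V → Set
  Only x a b = ∀ {y} → Adj x y → y ≡ a ⊎ y ≡ b

  -- The vertices of xs follow p and precede f on a walk that uses all edges
  -- at these vertices.
  Walk : V → List V → V → Set
  Walk p []       f = ⊤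
  Walk p (x ∷ xs) f = Only x p (first f xs) × Walk x xs f

  fixed-good : ∀ {A x p y} → Only x p y → InRow A true p → InRow A false y → FixedGood A x
  fixed-good {A} {x} {p} {y} only p∈ y∈ = nbr , locate
    where
    nbr : Bool → V
    nbr true  = p
    nbr false = y
    locate : ∀ {v} → Adj x v → ∃ λ c → v ≡ nbr c × InRow A c v
    locate adj with only adj
    ... | inj₁ refl = true , refl , p∈
    ... | inj₂ refl = false , refl , y∈

  row-vertex-good : ∀ {A c x a b} → Only x a b → Attached A c x a → Attached A c x b → RowGood A c x
  row-vertex-good only at-a at-b adj with only adj
  ... | inj₁ refl = at-a
  ... | inj₂ refl = at-b

  -- Stated for every larger layout, so that goodness survives the addition of further components.
  SelfGood : Layout → Set
  SelfGood A₀ = ∀ {A} → A₀ ⊆ A → All (Good A) A₀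

  Covered : Layout → V → Set
  Covered A v = fixed v ∈ A ⊎ ∃ λ c → InRow A c v

  InRow-⊆ : ∀ {A B c v} → A ⊆ B → InRow A c v → InRow B c v
  InRow-⊆ sub (in-spare p) = in-spare (sub p)
  InRow-⊆ sub (in-cross p) = in-cross (sub p)
  InRow-⊆ sub (in-pair₁ p) = in-pair₁ (sub p)
  InRow-⊆ sub (in-pair₂ p) = in-pair₂ (sub p)

  Covered-⊆ : ∀ {A B v} → A ⊆ B → Covered A v → Covered B v
  Covered-⊆ sub = Sum.map sub λ (c , p) → c , InRow-⊆ sub p

  order : Layout → ℕ
  order A = length (fixeds A) + 2 * width A

  -- Every block attains equality: one fixed vertex comes with a cross, two with a spare, one with a
  -- pair.
  Balanced : Layout → Set
  Balanced A = length (fixeds A) ≤ length (crosses A) + 2 * length (spares A) + length (pairs A)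

  -- `good` relies on two promises about the surroundings: `p` is in row `true` and `f` is fixed.
  -- `ends` and `starts` allow an adjacent block, or the same walk once closed, to keep them.
  record Extension (p : V) (x : V) (xs : List V) (f : V) (A₀ : Layout) : Set where
    field
      layout   : Layout
      extends  : A₀ ⊆ layout
      good     : ∀ {A} → layout ⊆ A → InRow A true p → fixed f ∈ A → All (Good A) A₀ → All (Good A) layout
      starts   : fixed x ∈ layout
      ends     : InRow layout true (last x xs)
      covers   : ∀ {v} → v ∈ x ∷ xs → Covered layout v
      size     : order layout ≡ length (x ∷ xs) + order A₀
      balanced : Balanced A₀ → Balanced layout

  -- Classes are assigned along the walk in blocks 012, 0102 and 01122, where 0
  -- stands for a fixed vertex and 1, 2 for the two rows. A block starts with 01
  -- and ends with 2, so each 0 has a neighbour in either row.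
  extend : ∀ p x y z xs f → Walk p (x ∷ y ∷ z ∷ xs) f → ∀ A₀ → Extension p x (y ∷ z ∷ xs) f A₀
  extend p x y z [] f (ox , oy , oz , _) A₀ = record
    { layout   = fixed x ∷ cross (y , z) ∷ A₀
    ; extends  = there ∘ there
    ; good     = λ sub p∈ f∈ gs →
        fixed-good ox p∈ (in-cross (sub (there (here refl)))) ∷
        (λ { false → row-vertex-good oy (inj₁ (sub (here refl))) (inj₂ (_ , across (of-cross (sub (there (here refl))))))
           ; true → row-vertex-good oz (inj₂ (_ , across (of-cross (sub (there (here refl)))))) (inj₁ f∈) }) ∷ gs
    ; starts   = here refl
    ; ends     = in-cross (there (here refl))
    ; covers   = λ { (here refl) → inj₁ (here refl)
                   ; (there (here refl)) → inj₂ (false , in-cross (there (here refl)))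
                   ; (there (there (here refl))) → inj₂ (true , in-cross (there (here refl))) }
    ; size     = l (length (fixeds A₀)) (length (pairs A₀)) (length (crosses A₀)) (length (spares A₀))
    ; balanced = s≤s
    }
    where
    l : ∀ z q e r → suc z + 2 * (2 * q + (suc e + r)) ≡ 3 + (z + 2 * (2 * q + (e + r)))
    l = solve-∀
  extend p x y x′ (z ∷ []) f (ox , oy , ox′ , oz , _) A₀ = record
    { layout   = fixed x ∷ fixed x′ ∷ spare (y , z) ∷ A₀
    ; extends  = there ∘ there ∘ there
    ; good     = λ sub p∈ f∈ gs →
        let yz∈ = sub (there (there (here refl))) in
        fixed-good ox p∈ (in-spare yz∈) ∷
        -- The second 0 of a block 0102 is entered from row `false` and left towards row `true`,
        -- against the usual order.
        fixed-good (Sum.swap ∘ ox′) (in-spare yz∈) (in-spare yz∈) ∷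
        (λ { false → row-vertex-good oy (inj₁ (sub (here refl))) (inj₁ (sub (there (here refl))))
           ; true → row-vertex-good oz (inj₁ (sub (there (here refl)))) (inj₁ f∈) }) ∷ gs
    ; starts   = here refl
    ; ends     = in-spare (there (there (here refl)))
    ; covers   = λ { (here refl) → inj₁ (here refl)
                   ; (there (here refl)) → inj₂ (false , in-spare (there (there (here refl))))
                   ; (there (there (here refl))) → inj₁ (there (here refl))
                   ; (there (there (there (here refl)))) → inj₂ (true , in-spare (there (there (here refl)))) }
    ; size     = l (length (fixeds A₀)) (length (pairs A₀)) (length (crosses A₀)) (length (spares A₀))
    ; balanced = λ b → ≤-trans (s≤s (s≤s b)) (≤-reflexive
        (l′ (length (crosses A₀)) (length (spares A₀)) (length (pairs A₀))))
    }
    where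
    l : ∀ z q e r → suc (suc z) + 2 * (2 * q + (e + suc r)) ≡ 4 + (z + 2 * (2 * q + (e + r)))
    l = solve-∀
    l′ : ∀ e r q → 2 + (e + 2 * r + q) ≡ e + 2 * suc r + q
    l′ = solve-∀
  extend p x a b (c ∷ d ∷ []) f (ox , oa , ob , oc , od , _) A₀ = record
    { layout   = fixed x ∷ pair (a , d) (b , c) ∷ A₀
    ; extends  = there ∘ there
    ; good     = λ sub p∈ f∈ gs →
        let q∈ = sub (there (here refl)) in
        fixed-good ox p∈ (in-pair₁ q∈) ∷
        (λ { false → row-vertex-good oa (inj₁ (sub (here refl))) (inj₂ (_ , along q∈)) ,
                     row-vertex-good ob (inj₂ (_ , backward q∈)) (inj₂ (_ , across (of-pair q∈)))
           ; true → row-vertex-good od (inj₂ (_ , along q∈)) (inj₁ f∈) ,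
                    row-vertex-good oc (inj₂ (_ , across (of-pair q∈))) (inj₂ (_ , backward q∈)) }) ∷ gs
    ; starts   = here refl
    ; ends     = in-pair₁ (there (here refl))
    ; covers   = λ { (here refl) → inj₁ (here refl)
                   ; (there (here refl)) → inj₂ (false , in-pair₁ (there (here refl)))
                   ; (there (there (here refl))) → inj₂ (false , in-pair₂ (there (here refl)))
                   ; (there (there (there (here refl)))) → inj₂ (true , in-pair₂ (there (here refl)))
                   ; (there (there (there (there (here refl))))) → inj₂ (true , in-pair₁ (there (here refl))) }
    ; size     = l (length (fixeds A₀)) (length (pairs A₀)) (length (crosses A₀)) (length (spares A₀))
    ; balanced = λ b → ≤-trans (s≤s b) (≤-reflexive
        (l′ (length (crosses A₀)) (length (spares A₀)) (length (pairs A₀))))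
    }
    where
    l : ∀ z q e r → suc z + 2 * (2 * suc q + (e + r)) ≡ 5 + (z + 2 * (2 * q + (e + r)))
    l = solve-∀
    l′ : ∀ e r q → 1 + (e + 2 * r + q) ≡ e + 2 * r + suc q
    l′ = solve-∀
  -- With six or more vertices, cutting off 012 leaves at least three, so the recursion ends at
  -- length 3, 4 or 5.
  extend p x y z (u ∷ v ∷ w ∷ xs) f (ox , oy , oz , walk) A₀ = record
    { layout   = fixed x ∷ cross (y , z) ∷ layout
    ; extends  = there ∘ there ∘ extends
    ; good     = λ sub p∈ f∈ gs →
        let yz∈ = sub (there (here refl)) in
        fixed-good ox p∈ (in-cross yz∈) ∷
        (λ { false → row-vertex-good oy (inj₁ (sub (here refl))) (inj₂ (_ , across (of-cross yz∈)))
           ; true → row-vertex-good oz (inj₂ (_ , across (of-cross yz∈))) (inj₁ (sub (there (there starts)))) }) ∷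
        good (sub ∘ there ∘ there) (in-cross yz∈) f∈ gs
    ; starts   = here refl
    ; ends     = InRow-⊆ (there ∘ there) ends
    ; covers   = λ { (here refl) → inj₁ (here refl)
                   ; (there (here refl)) → inj₂ (false , in-cross (there (here refl)))
                   ; (there (there (here refl))) → inj₂ (true , in-cross (there (here refl)))
                   ; (there (there (there v∈))) → Covered-⊆ (there ∘ there) (covers v∈) }
    ; size     = trans (l (length (fixeds layout)) (length (pairs layout)) (length (crosses layout))
                   (length (spares layout)))
                   (cong (3 +_) size)
    ; balanced = s≤s ∘ balanced
    }
    where
    open Extension (extend z u v w xs f walk A₀)
    l : ∀ z q e r → suc z + 2 * (2 * q + (suc e + r)) ≡ 3 + (z + 2 * (2 * q + (e + r)))
    l = solve-∀

-- Components of a graph with maximum degree at most two.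

module _ {P : Pred X 0ℓ} (P? : Decidable P) where

  private
    count-tail : ∀ {n} x (xs : Vec.Vec X n) → Vec.count P? xs ≤ Vec.count P? (x Vec.∷ xs)
    count-tail x xs with P? x
    ... | yes _ = n≤1+n _
    ... | no _  = ≤-refl

    count-head : ∀ {n x} (xs : Vec.Vec X n) → P x → Vec.count P? (x Vec.∷ xs) ≡ suc (Vec.count P? xs)
    count-head {x = x} xs px with P? x
    ... | yes _  = refl
    ... | no ¬px = contradiction px ¬px

  count≥1 : ∀ {n} (xs : Vec.Vec X n) {i} → P (Vec.lookup xs i) → 1 ≤ Vec.count P? xs
  count≥1 (x Vec.∷ xs) {zero}  p = subst (1 ≤_) (sym (count-head xs p)) (s≤s z≤n)
  count≥1 (x Vec.∷ xs) {suc i} p = ≤-trans (count≥1 xs p) (count-tail x xs)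

  count≥2 : ∀ {n} (xs : Vec.Vec X n) {i j} → i Fin.< j →
            P (Vec.lookup xs i) → P (Vec.lookup xs j) → 2 ≤ Vec.count P? xs
  count≥2 (x Vec.∷ xs) {zero}  {suc j} _ p q = subst (2 ≤_) (sym (count-head xs p)) (s≤s (count≥1 xs q))
  count≥2 (x Vec.∷ xs) {suc i} {suc j} (s≤s i<j) p q = ≤-trans (count≥2 xs i<j p q) (count-tail x xs)

  count≥3 : ∀ {n} (xs : Vec.Vec X n) {i j k} → i Fin.< j → j Fin.< k →
            P (Vec.lookup xs i) → P (Vec.lookup xs j) → P (Vec.lookup xs k) → 3 ≤ Vec.count P? xs
  count≥3 (x Vec.∷ xs) {zero}  {suc j} {suc k} _ (s≤s j<k) p q r =
    subst (3 ≤_) (sym (count-head xs p)) (s≤s (count≥2 xs j<k q r))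
  count≥3 (x Vec.∷ xs) {suc i} {suc j} {suc k} (s≤s i<j) (s≤s j<k) p q r =
    ≤-trans (count≥3 xs i<j j<k p q r) (count-tail x xs)

Unique-++⁻ : ∀ (xs : List X) {ys} → Unique (xs ++ ys) →
             Unique xs × Unique ys × (∀ {v} → v ∈ xs → v ∉ ys)
Unique-++⁻ [] uniq = [] , uniq , λ ()
Unique-++⁻ (x ∷ xs) (x≢ ∷ uniq) =
  let uniq₁ , uniq₂ , disjoint = Unique-++⁻ xs uniq
  in Allₚ.++⁻ˡ xs x≢ ∷ uniq₁ , uniq₂ ,
     λ { (here refl) v∈ → All.lookup x≢ (∈-++⁺ʳ xs v∈) refl ; (there v∈′) v∈ → disjoint v∈′ v∈ }

module Components {n} (G : Graph n) (Δ≤2 : Δ G ≤ 2) where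
  open Graph G using (Adj; adj?) renaming (sym to Adj-sym; irrefl to Adj-irrefl)
  open Layouts G using (V; Layout; fixed; cross; of-cross; in-cross; across; Attached; Good;
    fixeds; spares; crosses; pairs)
  open Arranging G
  open Chunking G

  degree≤2 : ∀ x → degree G x ≤ 2
  degree≤2 x = ≤-trans (All.lookup (xs≤max 0 (map (degree G) (allFinₗ n)))
    (∈-map⁺ (degree G) (∈-allFin x))) Δ≤2

  -- A third neighbour would raise the degree to three; the cases sort the three vertices, as
  -- `count≥3` expects increasing indices.
  two-neighbours : ∀ {x a b} → Adj x a → Adj x b → a ≢ b → Only x a b
  two-neighbours {x} {a} {b} xa xb a≢b {y} xy = cases (Finₚ.<-cmp a b) (Finₚ.<-cmp y a) (Finₚ.<-cmp y b)
    where
    vs = Vec.allFin n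
    at : ∀ {v} → Adj x v → Adj x (Vec.lookup vs v)
    at {v} = subst (Adj x) (sym (Vecₚ.lookup-allFin v))
    excess : ∀ {i j k} → i Fin.< j → j Fin.< k → Adj x i → Adj x j → Adj x k → ⊥
    excess i<j j<k p q r =
      <⇒≱ (count≥3 (adj? x) vs i<j j<k (at p) (at q) (at r)) (degree≤2 x)
    cases : _ → _ → _ → y ≡ a ⊎ y ≡ b
    cases (tri≈ _ a≡b _) _ _ = contradiction a≡b a≢b
    cases _ (tri≈ _ y≡a _) _ = inj₁ y≡a
    cases _ _ (tri≈ _ y≡b _) = inj₂ y≡b
    cases (tri< a<b _ _) (tri< y<a _ _) _ = ⊥-elim (excess y<a a<b xy xa xb)
    cases (tri< _ _ _) (tri> _ _ a<y) (tri< y<b _ _) = ⊥-elim (excess a<y y<b xa xy xb)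
    cases (tri< a<b _ _) (tri> _ _ _) (tri> _ _ b<y) = ⊥-elim (excess a<b b<y xa xb xy)
    cases (tri> _ _ b<a) (tri> _ _ a<y) _ = ⊥-elim (excess b<a a<y xb xa xy)
    cases (tri> _ _ _) (tri< y<a _ _) (tri> _ _ b<y) = ⊥-elim (excess b<y y<a xb xy xa)
    cases (tri> _ _ b<a) (tri< _ _ _) (tri< y<b _ _) = ⊥-elim (excess y<b b<a xy xb xa)

  Unique-resp-↭ : ∀ {xs ys : List V} → xs ↭ ys → Unique xs → Unique ys
  Unique-resp-↭ p = Permutationₛ.Unique-resp-↭ (setoid V) (↭⇒↭ₛ p)

  Unrelated : V → List V → Set
  Unrelated x ys = ∀ {y} → y ∈ ys → ¬ Adj x y

  record Prolongation (a : V) (as R : List V) : Set where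
    field
      {b}       : V
      {bs rest} : List V
      linked    : Linked Adj (b ∷ bs)
      perm      : (b ∷ bs) ++ rest ↭ (a ∷ as) ++ R
      same-last : last b bs ≡ last a as
      stuck     : Unrelated b rest
      rest⊆     : rest ⊆ R

  prolong : ∀ N {a as R} → length R ≤ N → Linked Adj (a ∷ as) → Prolongation a as R
  prolong N {a} {as} {R} len linked with Any.any? (adj? a) R
  ... | no none = record { linked = linked ; perm = ↭-refl ; same-last = refl
                         ; stuck = λ y∈ adj → none (Any.map (λ { refl → adj }) y∈) ; rest⊆ = id }
  ... | yes some with find some
  ... | y , y∈ , adj with ∈-∃++ y∈
  prolong zero {R = _} () _ | yes _ | y , _ , adj | [] , ys , refl
  prolong zero {R = _} () _ | yes _ | y , _ , adj | _ ∷ _ , ys , refl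
  prolong (suc N) {a} {as} len linked | yes _ | y , y∈ , adj | xs , ys , refl = record
    { linked = E.linked
    ; perm = ↭-trans E.perm (↭-trans (↭-sym (shift y (a ∷ as) (xs ++ ys)))
               (++⁺ˡ (a ∷ as) (↭-sym (shift y xs ys))))
    ; same-last = E.same-last
    ; stuck = E.stuck
    ; rest⊆ = λ v∈ → ∈-resp-↭ (↭-sym (shift y xs ys)) (there (E.rest⊆ v∈))
    }
    where
    shorter : length (xs ++ ys) ≤ N
    shorter = s≤s⁻¹ (subst (_≤ suc N) (↭-length (shift y xs ys)) len)
    module E = Prolongation (prolong N {y} {a ∷ as} {xs ++ ys} shorter (Adj-sym adj ∷ linked))

  -- Brings the other end of a path to the front, where `prolong` works.
  reverse-path : ∀ a acc as → Linked Adj (a ∷ acc) → Linked Adj (a ∷ as) → ∃ λ cs →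
    Linked Adj (last a as ∷ cs) × last (last a as) cs ≡ last a acc ×
    last a as ∷ cs ↭ (a ∷ acc) ++ as
  reverse-path a acc [] linked _ = acc , linked , refl , ↭-reflexive (sym (Listₚ.++-identityʳ (a ∷ acc)))
  reverse-path a acc (x ∷ as) linked (ax ∷ linked′) =
    let cs , l , eq , perm = reverse-path x (a ∷ acc) as (Adj-sym ax ∷ linked) linked′
    in cs , l , eq , ↭-trans perm (↭-sym (shift x (a ∷ acc) as))

  record MaximalPath (R : List V) : Set where
    field
      {a}        : V
      {as rest}  : List V
      linked     : Linked Adj (a ∷ as)
      perm       : (a ∷ as) ++ rest ↭ R
      stuck      : Unrelated a rest
      stuck-last : Unrelated (last a as) rest

  maximal-path : ∀ x R → MaximalPath (x ∷ R)
  maximal-path x R = record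
    { linked = Q.linked
    ; perm = ↭-trans Q.perm (↭-trans (++⁺ʳ P.rest perm) P.perm)
    ; stuck = Q.stuck
    ; stuck-last = λ y∈ → subst (λ v → ¬ Adj v _) (sym (trans Q.same-last same-last)) (P.stuck (Q.rest⊆ y∈))
    }
    where
    module P = Prolongation (prolong (length R) {x} {[]} {R} ≤-refl [-])
    reversed = reverse-path P.b [] P.bs [-] P.linked
    linked = proj₁ (proj₂ reversed)
    same-last = proj₁ (proj₂ (proj₂ reversed))
    perm = proj₂ (proj₂ (proj₂ reversed))
    module Q = Prolongation (prolong (length P.rest) {R = P.rest} ≤-refl linked)

  Closed : List V → Set
  Closed R = ∀ {x y} → x ∈ R → Adj x y → y ∈ R

  Unique⇒≢ : ∀ {x : V} {xs} → Unique (x ∷ xs) → ∀ {y} → y ∈ xs → x ≢ y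
  Unique⇒≢ (x≢ ∷ _) = All.lookup x≢

  -- An inner vertex of a path already has two neighbours on the path.
  outer-neighbour-last : ∀ {d} x xs → Linked Adj (x ∷ xs) → Unique (x ∷ xs) → d ∉ x ∷ xs →
    ∀ {y} → y ∈ xs → Adj d y → y ≡ last x xs
  outer-neighbour-last x (y ∷ []) _ _ _ (here refl) _ = refl
  outer-neighbour-last x (y ∷ z ∷ zs) (xy ∷ yz ∷ _) uniq d∉ (here refl) dy
    with two-neighbours (Adj-sym xy) yz (Unique⇒≢ uniq (there (here refl))) (Adj-sym dy)
  ... | inj₁ refl = contradiction (here refl) d∉
  ... | inj₂ refl = contradiction (there (there (here refl))) d∉
  outer-neighbour-last x (z ∷ zs) (_ ∷ linked) (_ ∷ uniq) d∉ (there y∈) dy =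
    outer-neighbour-last z zs linked uniq (d∉ ∘ there) y∈ dy

  -- Inner vertices have both neighbours on the path. When the induction drops `a`, an edge from the
  -- last vertex back to `a` must be excluded unless `a ≡ f`: the neighbours `p` and `x` already
  -- exhaust those of `a`.
  path-walk : ∀ a x xs f → Linked Adj (a ∷ x ∷ xs) → Unique (a ∷ x ∷ xs) →
    a ≡ f ⊎ (∃ λ p → Adj a p × p ∉ x ∷ xs) →
    (∀ {y} → Adj (last x xs) y → y ≡ f ⊎ y ∈ a ∷ x ∷ xs) → Walk a (x ∷ xs) f
  path-walk a x [] f _ _ _ end = only , tt
    where
    only : Only x a f
    only xy with end xy
    ... | inj₁ y≡f = inj₂ y≡f
    ... | inj₂ (here y≡a) = inj₁ y≡a
    ... | inj₂ (there (here refl)) = contradiction xy (Adj-irrefl refl)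
  path-walk a x (z ∷ zs) f (ax ∷ xz ∷ linked) uniq@(_ ∷ uniq′) start-at end =
    two-neighbours (Adj-sym ax) xz (Unique⇒≢ uniq (there (here refl))) ,
    path-walk x z zs f (xz ∷ linked) uniq′
      (inj₂ (a , Adj-sym ax , λ a∈ → Unique⇒≢ uniq (there a∈) refl)) end′
    where
    from-start : ∀ {y} → y ≡ a → Adj (last z zs) y → a ≡ f ⊎ (∃ λ p → Adj a p × p ∉ x ∷ z ∷ zs) → y ≡ f
    from-start y≡a _ (inj₁ a≡f) = trans y≡a a≡f
    from-start refl ly (inj₂ (p , ap , p∉))
      with two-neighbours ap ax (λ { refl → p∉ (here refl) }) (Adj-sym ly)
    ... | inj₁ l≡p = contradiction (subst (_∈ _) l≡p (there (last-∈ z zs))) p∉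
    ... | inj₂ l≡x = contradiction (sym l≡x) (Unique⇒≢ uniq′ (last-∈ z zs))
    end′ : ∀ {y} → Adj (last z zs) y → y ≡ f ⊎ y ∈ x ∷ z ∷ zs
    end′ ly with end ly
    ... | inj₁ y≡f         = inj₁ y≡f
    ... | inj₂ (here y≡a)  = inj₁ (from-start y≡a ly start-at)
    ... | inj₂ (there y∈)  = inj₂ y∈

  -- If no edge leaves the path at its ends, the only edge it can lack joins the two ends. Paths and
  -- cycles thus become closed walks alike.
  path-closes : ∀ a as → Linked Adj (a ∷ as) → Unique (a ∷ as) →
    (∀ {y} → Adj a y → y ∈ a ∷ as) → (∀ {y} → Adj (last a as) y → y ∈ a ∷ as) →
    Walk (last a as) (a ∷ as) a
  path-closes a [] _ _ on-a on-last = only , tt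
    where
    only : Only a a a
    only ay with on-a ay
    ... | here y≡a = inj₁ y≡a
  path-closes a (x ∷ xs) linked uniq@(_ ∷ uniq′) on-a on-last =
    only , path-walk a x xs a linked uniq (inj₁ refl) (inj₂ ∘ on-last)
    where
    only : Only a (last x xs) x
    only ay with on-a ay
    ... | here refl = contradiction ay (Adj-irrefl refl)
    ... | there (here y≡x) = inj₂ y≡x
    ... | there (there y∈) = inj₁ (outer-neighbour-last x xs (Linked.tail linked) uniq′
                               (λ a∈ → Unique⇒≢ uniq a∈ refl) y∈ ay)

  walk-closed : ∀ {p xs f v y} → Walk p xs f → v ∈ xs → Adj v y → y ≡ p ⊎ y ≡ f ⊎ y ∈ xs
  walk-closed {xs = v ∷ xs} (only , _) (here refl) vy with only vy
  ... | inj₁ y≡p = inj₁ y≡p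
  walk-closed {xs = v ∷ []}     _ (here refl) vy | inj₂ y≡f = inj₂ (inj₁ y≡f)
  walk-closed {xs = v ∷ _ ∷ _} _ (here refl) vy | inj₂ y≡x = inj₂ (inj₂ (there (here y≡x)))
  walk-closed (_ , walk) (there v∈) vy with walk-closed walk v∈ vy
  ... | inj₁ y≡x        = inj₂ (inj₂ (here y≡x))
  ... | inj₂ (inj₁ y≡f) = inj₂ (inj₁ y≡f)
  ... | inj₂ (inj₂ y∈)  = inj₂ (inj₂ (there y∈))

  record Component (R : List V) : Set where
    field
      {a}       : V
      {as rest} : List V
      perm      : (a ∷ as) ++ rest ↭ R
      walk      : Walk (last a as) (a ∷ as) a
      closed    : Closed rest

  component : ∀ x R → Closed (x ∷ R) → Unique (x ∷ R) → Component (x ∷ R)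
  component x R closed uniq = record { perm = M.perm ; walk = walk ; closed = closed-rest }
    where
    module M = MaximalPath (maximal-path x R)
    path = M.a ∷ M.as
    parts = Unique-++⁻ path (Unique-resp-↭ (↭-sym M.perm) uniq)
    closed-all : Closed (path ++ M.rest)
    closed-all v∈ adj = ∈-resp-↭ (↭-sym M.perm) (closed (∈-resp-↭ M.perm v∈) adj)
    on-path : ∀ {v} → v ∈ path → Unrelated v M.rest → ∀ {y} → Adj v y → y ∈ path
    on-path v∈ unrelated vy with ∈-++⁻ path (closed-all (∈-++⁺ˡ v∈) vy)
    ... | inj₁ y∈ = y∈
    ... | inj₂ y∈ = contradiction vy (unrelated y∈)
    walk : Walk (last M.a M.as) path M.a
    walk = path-closes M.a M.as M.linked (proj₁ parts)
      (on-path (here refl) M.stuck) (on-path (last-∈ M.a M.as) M.stuck-last)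
    closed-path : Closed path
    closed-path v∈ vy with walk-closed walk v∈ vy
    ... | inj₁ refl        = last-∈ M.a M.as
    ... | inj₂ (inj₁ refl) = here refl
    ... | inj₂ (inj₂ y∈)   = y∈
    closed-rest : Closed M.rest
    closed-rest v∈ vy with ∈-++⁻ path (closed-all (∈-++⁺ʳ path v∈) vy)
    ... | inj₂ y∈ = y∈
    ... | inj₁ y∈ = contradiction v∈ (proj₂ (proj₂ parts) (closed-path y∈ (Adj-sym vy)))

  -- Collecting the components into one layout.

  -- Components of one or two vertices can be strung together: no edge runs between them, so the
  -- ends `p` and `f` are arbitrary and the string may be closed into a cycle.
  Lane : List V → Set
  Lane xs = ∀ p f → Walk p xs f

  record Decomposition (R : List V) : Set where
    field
      layout   : Layout
      lane     : List V
      good     : SelfGood layout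
      walks    : Lane lane
      covers   : ∀ {v} → v ∈ R → Covered layout v ⊎ v ∈ lane
      size     : order layout + length lane ≡ length R
      balanced : Balanced layout

  lane-cons₁ : ∀ {a xs} → (∀ {y} → ¬ Adj a y) → Lane xs → Lane (a ∷ xs)
  lane-cons₁ isolated walks p f = (λ adj → contradiction adj isolated) , walks _ f

  lane-cons₂ : ∀ {a b xs} → Only a b b → Only b a a → Lane xs → Lane (a ∷ b ∷ xs)
  lane-cons₂ oa ob walks p f =
    (λ adj → inj₂ ([ id , id ]′ (oa adj))) , (λ adj → inj₁ ([ id , id ]′ (ob adj))) , walks _ f

  decompose : ∀ N R → length R ≤ N → Closed R → Unique R → Decomposition R
  decompose N [] _ _ _ = record
    { layout = [] ; lane = [] ; good = λ _ → [] ; walks = λ _ _ → tt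
    ; covers = λ () ; size = refl ; balanced = z≤n }
  decompose (suc N) (x ∷ R) (s≤s len) closed uniq = add C.as C.perm C.walk
    where
    module C = Component (component x R closed uniq)
    rest-uniq : Unique C.rest
    rest-uniq = proj₁ (proj₂ (Unique-++⁻ (C.a ∷ C.as) (Unique-resp-↭ (↭-sym C.perm) uniq)))
    shorter : length C.rest ≤ N
    shorter = ≤-trans (s≤s⁻¹ (≤-trans (s≤s (subst (length C.rest ≤_)
        (sym (Listₚ.length-++ C.as)) (m≤n+m _ (length C.as))))
      (≤-reflexive (↭-length C.perm)))) len
    module D = Decomposition (decompose N C.rest shorter C.closed rest-uniq)
    sized : ∀ as → (C.a ∷ as) ++ C.rest ↭ x ∷ R →
            suc (length as) + (order D.layout + length D.lane) ≡ suc (length R)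
    sized as perm = trans (cong (suc (length as) +_) D.size)
      (trans (sym (Listₚ.length-++ (C.a ∷ as))) (↭-length perm))
    covered : ∀ as → (C.a ∷ as) ++ C.rest ↭ x ∷ R → ∀ {v} → v ∈ x ∷ R →
              v ∈ C.a ∷ as ⊎ Covered D.layout v ⊎ v ∈ D.lane
    covered as perm v∈ = Sum.map id D.covers (∈-++⁻ (C.a ∷ as) (∈-resp-↭ (↭-sym perm) v∈))
    add : ∀ as → (C.a ∷ as) ++ C.rest ↭ x ∷ R → Walk (last C.a as) (C.a ∷ as) C.a → Decomposition (x ∷ R)
    add [] perm (only , _) = record
      { layout = D.layout ; lane = C.a ∷ D.lane ; good = D.good ; balanced = D.balanced
      ; walks = lane-cons₁ (λ adj → Adj-irrefl (sym ([ id , id ]′ (only adj))) adj) D.walks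
      ; covers = λ v∈ → case covered [] perm v∈ of λ
          { (inj₁ (here eq)) → inj₂ (here eq)
          ; (inj₂ (inj₁ c)) → inj₁ c
          ; (inj₂ (inj₂ l)) → inj₂ (there l) }
      ; size = trans (l (order D.layout) (length D.lane)) (sized [] perm)
      }
      where
      l : ∀ o m → o + suc m ≡ 1 + (o + m)
      l = solve-∀
    add (b ∷ []) perm (only , only′ , _) = record
      { layout = D.layout ; lane = C.a ∷ b ∷ D.lane ; good = D.good ; balanced = D.balanced
      ; walks = lane-cons₂ only only′ D.walks
      ; covers = λ v∈ → case covered (b ∷ []) perm v∈ of λ
          { (inj₁ (here eq)) → inj₂ (here eq)
          ; (inj₁ (there (here eq))) → inj₂ (there (here eq))
          ; (inj₂ (inj₁ c)) → inj₁ c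
          ; (inj₂ (inj₂ l)) → inj₂ (there (there l)) }
      ; size = trans (l (order D.layout) (length D.lane)) (sized (b ∷ []) perm)
      }
      where
      l : ∀ o m → o + suc (suc m) ≡ 2 + (o + m)
      l = solve-∀
    add (b ∷ c ∷ cs) perm walk = record
      { layout = E.layout ; lane = D.lane
      -- The walk is closed: its last vertex serves as `p` and its first as `f`.
      ; good = λ sub → E.good sub (InRow-⊆ sub E.ends) (sub E.starts) (D.good (sub ∘ E.extends))
      ; balanced = E.balanced D.balanced
      ; walks = D.walks
      ; covers = λ v∈ → case covered (b ∷ c ∷ cs) perm v∈ of λ
          { (inj₁ v∈c) → inj₁ (E.covers v∈c)
          ; (inj₂ (inj₁ c)) → inj₁ (Covered-⊆ E.extends c)
          ; (inj₂ (inj₂ l)) → inj₂ l }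
      ; size = trans (cong (_+ length D.lane) E.size)
          (trans (+-assoc (length (C.a ∷ b ∷ c ∷ cs)) (order D.layout) (length D.lane)) (sized (b ∷ c ∷ cs) perm))
      }
      where
      module E = Extension (extend (last c cs) C.a b c cs C.a walk D.layout)

  record GoodLayout : Set where
    field
      layout   : Layout
      good     : All (Good layout) layout
      covers   : ∀ v → Covered layout v
      size     : order layout ≡ n
      balanced : length (fixeds layout) ≤
        length (crosses layout) + 2 * length (spares layout) + length (pairs layout) + 1

  good-layout : GoodLayout
  good-layout = finish D.lane D.walks (λ v → D.covers (∈-allFin v)) (trans D.size (Listₚ.length-tabulate id))
    where
    module D = Decomposition (decompose _ (allFinₗ n) ≤-refl (λ _ _ → ∈-allFin _) (Uniqueₚ.allFin⁺ n))
    finish : ∀ lane → Lane lane → (∀ v → Covered D.layout v ⊎ v ∈ lane) →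
             order D.layout + length lane ≡ n → GoodLayout
    finish [] _ covers size = record
      { layout = D.layout ; good = D.good id
      ; covers = λ v → [ id , (λ ()) ]′ (covers v)
      ; size = trans (sym (+-identityʳ _)) size
      ; balanced = m≤n⇒m≤n+o 1 D.balanced }
    -- A single leftover vertex is isolated and becomes fixed without a domino, which is the source
    -- of the `+ 1` in the balance. Its candidate neighbours are arbitrary.
    finish (x ∷ []) walks covers size = record
      { layout = fixed x ∷ D.layout
      ; good = ((λ _ → x) , λ adj → contradiction adj isolated) ∷ D.good there
      ; covers = λ v → case covers v of λ
          { (inj₁ c) → Covered-⊆ there c
          ; (inj₂ (here refl)) → inj₁ (here refl) }
      ; size = trans (+-comm 1 (order D.layout)) size
      ; balanced = ≤-trans (s≤s D.balanced) (≤-reflexive (+-comm 1 _)) }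
      where
      isolated : ∀ {y} → ¬ Adj x y
      isolated adj = Adj-irrefl (sym ([ id , id ]′ (proj₁ (walks x x) adj))) adj
    -- Two leftover vertices form a cross, adjacent or not; fixing both could violate the balance.
    finish (x ∷ y ∷ []) walks covers size = record
      { layout = cross (x , y) ∷ D.layout
      ; good = (λ { false → row-vertex-good (proj₁ (walks y x)) linked linked
                  ; true → row-vertex-good (proj₁ (proj₂ (walks y x))) linked′ linked′ }) ∷ D.good there
      ; covers = λ v → case covers v of λ
          { (inj₁ c) → Covered-⊆ there c
          ; (inj₂ (here refl)) → inj₂ (false , in-cross (here refl))
          ; (inj₂ (there (here refl))) → inj₂ (true , in-cross (here refl)) }
      ; size = trans (l (length (fixeds D.layout)) (length (pairs D.layout)) (length (crosses D.layout))
          (length (spares D.layout))) size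
      ; balanced = m≤n⇒m≤n+o 1 (m≤n⇒m≤1+n D.balanced) }
      where
      linked : Attached (cross (x , y) ∷ D.layout) false x y
      linked = inj₂ (true , across (of-cross (here refl)))
      linked′ : Attached (cross (x , y) ∷ D.layout) true y x
      linked′ = inj₂ (false , across (of-cross (here refl)))
      l : ∀ z q e r → z + 2 * (2 * q + (suc e + r)) ≡ z + 2 * (2 * q + (e + r)) + 2
      l = solve-∀
    finish (x ∷ y ∷ z ∷ zs) walks covers size = record
      { layout = E.layout
      ; good = E.good id E.ends E.starts (D.good E.extends)
      ; covers = λ v → [ Covered-⊆ E.extends , E.covers ]′ (covers v)
      ; size = trans E.size (trans (+-comm (length (x ∷ y ∷ z ∷ zs)) _) size)
      ; balanced = m≤n⇒m≤n+o 1 (E.balanced D.balanced) }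
      where
      module E = Extension (extend (last z zs) x y z zs x (walks _ x) D.layout)

theorem2p8 : ∀ (k : ℕ) → k ≥ 1 → ∀ (n : ℕ) (G : Graph n) → n ≥ 6 * k ∸ 4 → Δ G ≡ 2 → Placeable G k
-- A single copy has nothing to avoid; `k≤width` requires `2 ≤ k`.
theorem2p8 (suc zero) _ n G _ _ = (λ _ → id-permutation) , λ { zero zero 0≢0 → contradiction refl 0≢0 }
theorem2p8 k@(suc (suc _)) _ n G n≥ Δ≡2 =
  Arranging.good-layout⇒placeable G layout (s≤s (s≤s z≤n)) good covers size n≥ balanced
  where open Components.GoodLayout (Components.good-layout G (≤-reflexive Δ≡2))
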